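{- For any integers $n,m,k$ such that $2\le m\le n$ and $2\le k\le 2^{m-1}+1$, we have $$v_2(s(2^n,2^m-k)) = 2^n-2^m-(n-m)\Big(2^m-2\Big\lfloor\frac{k}{2}\Big\rfloor\Big) + m-2-v_2\Big(\Big\lfloor\frac{k}{2}\Big\rfloor\Big)+(n-1)\epsilon_k,$$ where $\epsilon_k=0$ if $k$ is even and $\epsilon_k=1$ if $k$ is odd.
   Context: For nonnegative integers $n,k$, the (unsigned) Stirling number of the first kind $s(n,k)$ is defined by $x(x+1)\cdots(x+n-1)=\sum_{k=0}^{n}s(n,k)x^k$ (the empty product for $n=0$ being $1$), and $s(n,k)=0$ for $k>n$; equivalently $s(n,k)$ counts permutations of $n$ elements with $k$ disjoint cycles. For a prime $p$ and a nonzero rational $x=n_1/n_2$, $v_p(x)=v_p(n_1)-v_p(n_2)$, where $v_p$ of a nonzero integer is the exponent of the largest power of $p$ dividing it. $\lfloor y\rfloor$ is the floor of $y$. -}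

module Defs where

open import Data.Nat using (ℕ; zero; suc; _+_; _*_; _^_; _/_)
open import Data.List using (List; []; _∷_; map)
open import Data.Integer using (ℤ; +_; _-_)
open import Data.Nat.Divisibility using (_∣_)
open import Relation.Nullary using (¬_)
open import Data.Product using (_×_)

-- Polynomials with natural coefficients, as coefficient lists (lowest degree first).
Poly : Set
Poly = List ℕ

_⊕_ : Poly → Poly → Poly
[] ⊕ q = q
(a ∷ p) ⊕ [] = a ∷ p
(a ∷ p) ⊕ (b ∷ q) = (a + b) ∷ (p ⊕ q)

mulXplus : ℕ → Poly → Poly
mulXplus j p = (0 ∷ p) ⊕ map (j *_) p

risingAux : ℕ → Poly
risingAux zero = 1 ∷ []
risingAux (suc n) = mulXplus n (risingAux n)

coeff : Poly → ℕ → ℕ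
coeff [] k = 0
coeff (a ∷ p) zero = a
coeff (a ∷ p) (suc k) = coeff p k

-- unsigned Stirling number of the first kind s(n,k):
-- x(x+1)...(x+n-1) = Σ_k s(n,k) x^k
stirling1 : ℕ → ℕ → ℕ
stirling1 n k = coeff (risingAux n) k

-- v_p(x) = e, for a nonzero natural x: p^e ∣ x and ¬ p^(e+1) ∣ x
-- (this forces x ≠ 0, since every power divides 0)
HasValuation : ℕ → ℕ → ℕ → Set
HasValuation p x e = (p ^ e ∣ x) × ¬ (p ^ suc e ∣ x)

ε : ℕ → ℕ
ε zero = 0
ε (suc zero) = 1
ε (suc (suc k)) = ε k

{-# OPTIONS --safe #-}
module Submission where

-- Write N = 2ⁿ, K = N/2. Pairing the factors x + j and x + (N − j) gives
--   x(x+1)⋯(x+N−1) = x(x+K) Q(x(x+N)),  where  P(X) = X Q(X) = ∏_{j<K} (X + j(N − j)).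
-- Let p_c be the coefficients of P. The factors of P with j even form a rescaled copy of the P for n − 1,
-- and the product R of the factors with j odd is congruent to (X+1)^(K/2) modulo K. With b = ⌊log₂ c⌋ and
--   χ(c) = Σ_{0<j<c} 2(⌊log₂ j⌋ + 2) = 2(b + 2)c − 4·2ᵇ,
-- induction on n yields v₂(c p_c) = 2ⁿ − 2nc + χ(c) + b for 0 < c ≤ K, because a single summand of the
-- convolution dominates: the one with index min(c, K/2) in the rescaled copy. Both s(N, 2c) and
-- s(N, 2c−1) are again sums with one dominant summand, p_c and K(2c−1)p_c respectively.
-- Negative exponents are avoided by working with the multiples 2^(2nc) p_c.

open import Defs

-- Multiplying p_c by c is the operator X d/dX. By the product rule, (d + e) f_d g_e = (d f_d) g_e +
-- f_d (e g_e), and both parts can be estimated: the first by induction, the second because e C(2ᵃ,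
-- e) = 2ᵃ C(2ᵃ - 1, e - 1) with an odd binomial on the right. The valuation of p_c itself contains
-- v₂(c), which does not follow a convolution. The function χ is forced. For c ≤ K/2 the dominant
-- summand is p_c of the previous stage times a power of 4 and an odd number, and the change of 2ⁿ -
-- 2nc absorbs that power, so χ does not depend on n. For K/2 < c < K it is the leading coefficient
-- 1 times R_(c - K/2); after multiplication by c its valuation is n - 2 = b, which requires χ(c) =
-- 2nc - 2ⁿ there. So χ has slope 2(b + 2) from 2ᵇ to 2ᵇ⁺¹. It is convex: c ↦ 2ⁿ - 2nc + χ(c) is the
-- Newton polygon of P, with vertices at the powers of two. The increase of the slopes is what lets
-- a single summand dominate.

module Naturals where

  open import Data.Empty using (⊥-elim)
  open import Data.List using ([]; _∷_; map)
  open import Data.Nat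
  open import Data.Nat.Divisibility
  open import Data.Nat.DivMod using (m≡m%n+[m/n]*n; [m+n]%n≡m%n)
  open import Data.Nat.Properties
  open import Data.Nat.Tactic.RingSolver using (solve; solve-∀)
  open import Data.Product using (∃; _×_; _,_; proj₁; proj₂)
  open import Data.Sum using (_⊎_; inj₁; inj₂)
  open import Function using (_∘_; id)
  open import Relation.Binary using (tri<; tri≈; tri>)
  open import Relation.Binary.PropositionalEquality
  open import Relation.Nullary using (¬_; yes; no)

  -- Products of linear factors, acting on coefficient sequences

  Coeffs : Set
  Coeffs = ℕ → ℕ

  δ : Coeffs
  δ zero    = 1
  δ (suc _) = 0

  -- Multiplication by X + a.
  L : ℕ → Coeffs → Coeffs
  L a f zero    = a * f zero
  L a f (suc k) = f k + a * f (suc k)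

  -- The starting sequence is a parameter, so that a product can be split by feeding one part to the
  -- other. `conv-Prod` turns this nesting into a convolution.
  Prod : (ℕ → ℕ) → ℕ → Coeffs → Coeffs
  Prod a zero    f = f
  Prod a (suc n) f = L (a n) (Prod a n f)

  L-cong : ∀ {a b f g} → a ≡ b → f ≗ g → L a f ≗ L b g
  L-cong {a} refl f≗g zero    = cong (a *_) (f≗g zero)
  L-cong {a} refl f≗g (suc k) = cong₂ _+_ (f≗g k) (cong (a *_) (f≗g (suc k)))

  L-comm : ∀ a b f → L a (L b f) ≗ L b (L a f)
  L-comm a b f zero = lem a b (f 0)
    where lem : ∀ a b x → a * (b * x) ≡ b * (a * x)
          lem = solve-∀
  L-comm a b f (suc zero) = lem a b (f 0) (f 1)
    where lem : ∀ a b x y → b * x + a * (x + b * y) ≡ a * x + b * (x + a * y)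
          lem = solve-∀
  L-comm a b f (suc (suc k)) = lem a b (f k) (f (suc k)) (f (suc (suc k)))
    where lem : ∀ a b x y z → x + b * y + a * (y + b * z) ≡ x + a * y + b * (y + a * z)
          lem = solve-∀

  Prod-cong : ∀ {a b f g} n → (∀ j → j < n → a j ≡ b j) → f ≗ g → Prod a n f ≗ Prod b n g
  Prod-cong zero    a≡b f≗g = f≗g
  Prod-cong (suc n) a≡b f≗g =
    L-cong (a≡b n ≤-refl) (Prod-cong n (λ j j<n → a≡b j (m≤n⇒m≤1+n j<n)) f≗g)

  Prod-L : ∀ a n b f → Prod a n (L b f) ≗ L b (Prod a n f)
  Prod-L a zero    b f k = refl
  Prod-L a (suc n) b f k =
    trans (L-cong {a n} refl (Prod-L a n b f) k) (L-comm (a n) b (Prod a n f) k)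

  Prod-+ : ∀ a m n f → Prod a (m + n) f ≗ Prod (λ j → a (m + j)) n (Prod a m f)
  Prod-+ a m zero    f k rewrite +-identityʳ m = refl
  Prod-+ a m (suc n) f k rewrite +-suc m n = L-cong refl (Prod-+ a m n f) k

  Prod-reverse : ∀ a n f → Prod a n f ≗ Prod (λ j → a (n ∸ suc j)) n f
  Prod-reverse a zero    f k = refl
  Prod-reverse a (suc n) f k = begin
    L (a n) (Prod a n f) k                                ≡⟨ L-cong refl (Prod-reverse a n f) k ⟩
    L (a n) (Prod (λ j → a (n ∸ suc j)) n f) k            ≡⟨ Prod-L (λ j → a (n ∸ suc j)) n (a n) f k ⟨
    Prod (λ j → a (n ∸ suc j)) n (L (a n) f) k            ≡⟨ Prod-+ (λ j → a (n ∸ j)) 1 n f k ⟨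
    Prod (λ j → a (n ∸ j)) (suc n) f k                    ∎
    where open ≡-Reasoning

  Prod-evens-odds : ∀ a n f →
    Prod a (2 * n) f ≗ Prod (λ j → a (1 + 2 * j)) n (Prod (λ j → a (2 * j)) n f)
  Prod-evens-odds a zero    f k = refl
  Prod-evens-odds a (suc n) f k rewrite +-suc n (n + 0) = begin
    L (a (1 + 2 * n)) (L (a (2 * n)) (Prod a (2 * n) f)) k
      ≡⟨ L-cong {a (1 + 2 * n)} refl (L-cong {a (2 * n)} refl (Prod-evens-odds a n f)) k ⟩
    L (a (1 + 2 * n)) (L (a (2 * n)) (Prod odds n (Prod evens n f))) k
      ≡⟨ L-cong {a (1 + 2 * n)} refl (λ i → sym (Prod-L odds n (a (2 * n)) (Prod evens n f) i)) k ⟩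
    L (a (1 + 2 * n)) (Prod odds n (L (a (2 * n)) (Prod evens n f))) k ∎
    where
    open ≡-Reasoning
    odds evens : ℕ → ℕ
    odds j = a (1 + 2 * j)
    evens j = a (2 * j)

  Prod-degree : ∀ a n k → n < k → Prod a n δ k ≡ 0
  Prod-degree a zero    (suc k) _ = refl
  Prod-degree a (suc n) (suc k) (s≤s n<k)
    rewrite Prod-degree a n k n<k | Prod-degree a n (suc k) (m≤n⇒m≤1+n n<k) = *-zeroʳ (a n)

  Prod-leading : ∀ a n → Prod a n δ n ≡ 1
  Prod-leading a zero = refl
  Prod-leading a (suc n)
    rewrite Prod-leading a n | Prod-degree a n (suc n) ≤-refl | *-zeroʳ (a n) = refl

  -- Substituting qX for X takes one q out of each of the n factors.
  Prod-scale : ∀ q a n k → q ^ k * Prod (λ j → q * a j) n δ k ≡ q ^ n * Prod a n δ k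
  Prod-scale q a zero    zero    = refl
  Prod-scale q a zero    (suc k) = trans (*-zeroʳ (q ^ suc k)) (sym (*-zeroʳ 1))
  Prod-scale q a (suc n) zero    =
    trans (lem q (a n) _) (trans (cong (q * a n *_) (Prod-scale q a n 0)) (lem′ q (a n) _ _))
    where lem : ∀ q a x → 1 * (q * a * x) ≡ q * a * (1 * x)
          lem = solve-∀
          lem′ : ∀ q a x y → q * a * (x * y) ≡ q * x * (a * y)
          lem′ = solve-∀
  Prod-scale q a (suc n) (suc k) =
    trans (lem q (a n) (q ^ k) _ _)
      (trans (cong₂ (λ x y → q * x + q * a n * y) (Prod-scale q a n k) (Prod-scale q a n (suc k)))
        (lem′ q (a n) (q ^ n) _ _))
    where lem : ∀ q a w x y → q * w * (x + q * a * y) ≡ q * (w * x) + q * a * (q * w * y)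
          lem = solve-∀
          lem′ : ∀ q a w x y → q * (w * x) + q * a * (w * y) ≡ q * w * (x + a * y)
          lem′ = solve-∀

  -- Convolution

  conv : Coeffs → Coeffs → Coeffs
  conv f g zero    = f 0 * g 0
  conv f g (suc k) = f 0 * g (suc k) + conv (f ∘ suc) g k

  conv-cong : ∀ {f f′ g g′} → f ≗ f′ → g ≗ g′ → conv f g ≗ conv f′ g′
  conv-cong p q zero    = cong₂ _*_ (p 0) (q 0)
  conv-cong p q (suc k) = cong₂ _+_ (cong₂ _*_ (p 0) (q (suc k))) (conv-cong (p ∘ suc) q k)

  conv-suc : ∀ f g k → conv f g (suc k) ≡ conv f (g ∘ suc) k + f (suc k) * g 0
  conv-suc f g zero    = refl
  conv-suc f g (suc k) =
    trans (cong (f 0 * g (suc (suc k)) +_) (conv-suc (f ∘ suc) g k))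
          (sym (+-assoc (f 0 * g (suc (suc k))) _ _))

  conv-comm : ∀ f g → conv f g ≗ conv g f
  conv-comm f g zero    = *-comm (f 0) (g 0)
  conv-comm f g (suc k) =
    trans (cong₂ _+_ (*-comm (f 0) (g (suc k))) (conv-comm (f ∘ suc) g k))
      (trans (+-comm (g (suc k) * f 0) _) (sym (conv-suc g f k)))

  conv-+ʳ : ∀ f g h m k → conv f (λ i → g i + m * h i) k ≡ conv f g k + m * conv f h k
  conv-+ʳ f g h m zero    = lem (f 0) (g 0) (h 0) m
    where lem : ∀ x y z m → x * (y + m * z) ≡ x * y + m * (x * z)
          lem = solve-∀
  conv-+ʳ f g h m (suc k) rewrite conv-+ʳ (f ∘ suc) g h m k =
    lem (f 0) (g (suc k)) (h (suc k)) m _ _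
    where lem : ∀ x y z m u v → x * (y + m * z) + (u + m * v) ≡ x * y + u + m * (x * z + v)
          lem = solve-∀

  conv-0ˡ : ∀ g k → conv (λ _ → 0) g k ≡ 0
  conv-0ˡ g zero    = refl
  conv-0ˡ g (suc k) = conv-0ˡ g k

  conv-δ : ∀ g → conv δ g ≗ g
  conv-δ g zero    = +-identityʳ (g 0)
  conv-δ g (suc k) rewrite conv-0ˡ g k = trans (+-identityʳ _) (+-identityʳ (g (suc k)))

  conv-L : ∀ a f g → conv f (L a g) ≗ L a (conv f g)
  conv-L a f g zero    = lem (f 0) a (g 0)
    where lem : ∀ x a y → x * (a * y) ≡ a * (x * y)
          lem = solve-∀
  conv-L a f g (suc zero)    = lem (f 0) (f 1) a (g 0) (g 1)
    where lem : ∀ x x′ a y z → x * (y + a * z) + x′ * (a * y) ≡ x * y + a * (x * z + x′ * y)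
          lem = solve-∀
  conv-L a f g (suc (suc k)) rewrite conv-L a (f ∘ suc) g (suc k) =
    lem (f 0) a (g (suc k)) (g (suc (suc k))) _ _
    where lem : ∀ x a y z u v → x * (y + a * z) + (u + a * v) ≡ x * y + u + a * (x * z + v)
          lem = solve-∀

  conv-Prod : ∀ a n f → Prod a n f ≗ conv (Prod a n δ) f
  conv-Prod a zero    f k = sym (conv-δ f k)
  conv-Prod a (suc n) f k = begin
    L (a n) (Prod a n f) k              ≡⟨ L-cong refl (conv-Prod a n f) k ⟩
    L (a n) (conv (Prod a n δ) f) k     ≡⟨ L-cong refl (conv-comm (Prod a n δ) f) k ⟩
    L (a n) (conv f (Prod a n δ)) k     ≡⟨ conv-L (a n) f (Prod a n δ) k ⟨
    conv f (L (a n) (Prod a n δ)) k     ≡⟨ conv-comm f _ k ⟩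
    conv (L (a n) (Prod a n δ)) f k     ∎
    where open ≡-Reasoning

  -- The substitution of wX for X respects products.
  conv-weight : ∀ w f g k → w ^ k * conv f g k ≡ conv (λ i → w ^ i * f i) (λ i → w ^ i * g i) k
  conv-weight w f g zero    = lem (f 0) (g 0)
    where lem : ∀ x y → 1 * (x * y) ≡ 1 * x * (1 * y)
          lem = solve-∀
  conv-weight w f g (suc k) = begin
    w * w ^ k * (f 0 * g (suc k) + conv (f ∘ suc) g k)
      ≡⟨ lem w (w ^ k) (f 0) (g (suc k)) (conv (f ∘ suc) g k) ⟩
    1 * f 0 * (w * w ^ k * g (suc k)) + w * (w ^ k * conv (f ∘ suc) g k)
      ≡⟨ cong (λ x → 1 * f 0 * (w * w ^ k * g (suc k)) + w * x) (conv-weight w (f ∘ suc) g k) ⟩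
    1 * f 0 * (w * w ^ k * g (suc k)) + w * conv (λ i → w ^ i * f (suc i)) (λ i → w ^ i * g i) k
      ≡⟨ cong (1 * f 0 * (w * w ^ k * g (suc k)) +_) (conv-*ˡ w (λ i → w ^ i * f (suc i)) (λ i → w ^ i * g i) k) ⟩
    1 * f 0 * (w * w ^ k * g (suc k)) + conv (λ i → w * (w ^ i * f (suc i))) (λ i → w ^ i * g i) k
      ≡⟨ cong (1 * f 0 * (w * w ^ k * g (suc k)) +_)
           (conv-cong (λ i → sym (*-assoc w (w ^ i) (f (suc i)))) (λ _ → refl) k) ⟩
    1 * f 0 * (w * w ^ k * g (suc k)) + conv (λ i → w * w ^ i * f (suc i)) (λ i → w ^ i * g i) k ∎
    where
    open ≡-Reasoning
    lem : ∀ w v x y z → w * v * (x * y + z) ≡ 1 * x * (w * v * y) + w * (v * z)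
    lem = solve-∀
    conv-*ˡ : ∀ m f g k → m * conv f g k ≡ conv (λ i → m * f i) g k
    conv-*ˡ m f g zero    = sym (*-assoc m (f 0) (g 0))
    conv-*ˡ m f g (suc k) rewrite sym (conv-*ˡ m (f ∘ suc) g k) = lem′ m (f 0) (g (suc k)) _
      where lem′ : ∀ m x y z → m * (x * y + z) ≡ m * x * y + m * z
            lem′ = solve-∀

  conv-∣ : ∀ {t} m f g k → (∀ d e → d + e ≡ k → t ∣ m * (f d * g e)) → t ∣ m * conv f g k
  conv-∣ m f g zero    h = h 0 0 refl
  conv-∣ {t} m f g (suc k) h = subst (t ∣_) (sym (*-distribˡ-+ m (f 0 * g (suc k)) _))
    (∣m∣n⇒∣m+n (h 0 (suc k) refl)
      (conv-∣ m (f ∘ suc) g k (λ d e eq → h (suc d) e (cong suc eq))))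

  -- The multiplier m stays outside the summands because the sharp estimates concern c p_c, not p_c;
  -- in `z-exact` it is c.
  conv-dominant : ∀ {t} m f g d₀ e₀ →
    (∀ d e → d + e ≡ d₀ + e₀ → d ≢ d₀ → t ∣ m * (f d * g e)) →
    ∃ λ u → m * conv f g (d₀ + e₀) ≡ m * (f d₀ * g e₀) + t * u
  conv-dominant {t} m f g zero zero h =
    0 , sym (trans (cong (m * (f 0 * g 0) +_) (*-zeroʳ t)) (+-identityʳ _))
  conv-dominant {t} m f g zero (suc e₀) h
    with conv-∣ {t} m (f ∘ suc) g e₀ (λ d e eq → h (suc d) e (cong suc eq) (λ ()))
  ... | divides u eq = u , trans (*-distribˡ-+ m _ _) (cong (m * (f 0 * g (suc e₀)) +_) (trans eq (*-comm u t)))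
  conv-dominant {t} m f g (suc d₀) e₀ h
    with conv-dominant {t} m (f ∘ suc) g d₀ e₀ (λ d e eq d≢ → h (suc d) e (cong suc eq) (d≢ ∘ suc-injective))
       | h 0 (suc (d₀ + e₀)) refl (λ ())
  ... | u , eq | divides v eq′ = u + v , trans (*-distribˡ-+ m (f 0 * g (suc (d₀ + e₀))) _)
      (trans (cong₂ _+_ eq′ eq) (lem v t _ u))
    where lem : ∀ v t x u → v * t + (x + t * u) ≡ x + t * (u + v)
          lem = solve-∀

  -- Powers of two and exact valuations

  2^-pos : ∀ a → 1 ≤ 2 ^ a
  2^-pos a = m^n>0 2 a

  2^-∣ : ∀ {a b} → a ≤ b → 2 ^ a ∣ 2 ^ b
  2^-∣ {a} a≤b with m≤n⇒∃[o]m+o≡n a≤b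
  ... | c , refl = divides (2 ^ c) (trans (^-distribˡ-+-* 2 a c) (*-comm (2 ^ a) (2 ^ c)))

  Odd : ℕ → Set
  Odd x = ∃ λ u → x ≡ 1 + 2 * u

  even-or-odd : ∀ x → (2 ∣ x) ⊎ Odd x
  even-or-odd zero = inj₁ (2 ∣0)
  even-or-odd (suc x) with even-or-odd x
  ... | inj₁ (divides u eq) = inj₂ (u , cong suc (trans eq (*-comm u 2)))
  ... | inj₂ (u , eq)       = inj₁ (divides (suc u) (trans (cong suc eq) (lem u)))
    where lem : ∀ u → 2 + 2 * u ≡ suc u * 2
          lem = solve-∀

  odd⇒¬2∣ : ∀ {x} → Odd x → ¬ 2 ∣ x
  odd⇒¬2∣ (u , refl) 2∣x with ∣1⇒≡1 (∣m+n∣m⇒∣n (subst (2 ∣_) (+-comm 1 (2 * u)) 2∣x) (m∣m*n u))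
  ... | ()

  odd-* : ∀ {x y} → Odd x → Odd y → Odd (x * y)
  odd-* (u , refl) (v , refl) = u + v + 2 * u * v , lem u v
    where lem : ∀ u v → (1 + 2 * u) * (1 + 2 * v) ≡ 1 + 2 * (u + v + 2 * u * v)
          lem = solve-∀

  odd-+even : ∀ {x y} → Odd x → 2 ∣ y → Odd (x + y)
  odd-+even (u , refl) (divides v refl) = u + v , lem u v
    where lem : ∀ u v → 1 + 2 * u + v * 2 ≡ 1 + 2 * (u + v)
          lem = solve-∀

  2^∣-odd-* : ∀ {t x y} → Odd y → 2 ^ t ∣ y * x → 2 ^ t ∣ x
  2^∣-odd-* {zero}  {x} odd h = 1∣ x
  2^∣-odd-* {suc t} {x} {y} odd h with even-or-odd x
  ... | inj₂ oddx = ⊥-elim (odd⇒¬2∣ (odd-* odd oddx) (∣-trans (m∣m*n (2 ^ t)) h))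
  ... | inj₁ (divides z refl) = subst (2 ^ suc t ∣_) (*-comm 2 z)
          (*-monoʳ-∣ 2 (2^∣-odd-* {t} odd (*-cancelˡ-∣ 2 (subst (2 ^ suc t ∣_) (lem y z) h))))
    where lem : ∀ y z → y * (z * 2) ≡ 2 * (y * z)
          lem = solve-∀

  -- A witness form of `HasValuation 2 x e`: an explicit odd cofactor multiplies well and absorbs an
  -- even error directly.
  record Exact (e x : ℕ) : Set where
    constructor exact
    field
      cofactor   : ℕ
      odd        : Odd cofactor
      factorised : x ≡ 2 ^ e * cofactor

  exact-+ : ∀ {e x y} → Exact e x → 2 ^ suc e ∣ y → Exact e (x + y)
  exact-+ {e} (exact o odd refl) (divides v refl) =
    exact (o + v * 2) (odd-+even odd (divides v refl)) (lem (2 ^ e) o v)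
    where lem : ∀ p o v → p * o + v * (2 * p) ≡ p * (o + v * 2)
          lem = solve-∀

  exact-* : ∀ {e f x y} → Exact e x → Exact f y → Exact (e + f) (x * y)
  exact-* {e} {f} (exact o odd refl) (exact o′ odd′ refl) = exact (o * o′) (odd-* odd odd′)
    (trans (lem (2 ^ e) (2 ^ f) o o′) (cong (_* (o * o′)) (sym (^-distribˡ-+-* 2 e f))))
    where lem : ∀ p q x y → p * x * (q * y) ≡ p * q * (x * y)
          lem = solve-∀

  exact-2^ : ∀ e → Exact e (2 ^ e)
  exact-2^ e = exact 1 (0 , refl) (sym (*-identityʳ _))

  exact-odd : ∀ {x} → Odd x → Exact 0 x
  exact-odd {x} odd = exact x odd (sym (+-identityʳ x))

  exact-∣ : ∀ {e x} → Exact e x → 2 ^ e ∣ x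
  exact-∣ (exact o _ refl) = m∣m*n o

  exact-¬∣ : ∀ {e x} → Exact e x → ¬ 2 ^ suc e ∣ x
  exact-¬∣ {e} (exact o odd refl) h = odd⇒¬2∣ odd
    (*-cancelˡ-∣ (2 ^ e) {{m^n≢0 2 e}} (subst (_∣ 2 ^ e * o) (*-comm 2 (2 ^ e)) h))

  ∣-¬∣⇒exact : ∀ {e x} → 2 ^ e ∣ x → ¬ 2 ^ suc e ∣ x → Exact e x
  ∣-¬∣⇒exact {e} (divides q refl) ¬h with even-or-odd q
  ... | inj₂ odd  = exact q odd (*-comm q (2 ^ e))
  ... | inj₁ 2∣q = ⊥-elim (¬h (*-monoˡ-∣ (2 ^ e) 2∣q))

  -- A Stirling number is reached only through a multiple of it, and this divides the multiplier
  -- out. The exponent is described by an equation, since e - f would be truncated.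
  exact-cancel : ∀ {f e x y} → Exact f x → Exact e (x * y) → ∃ λ v → Exact v y × f + v ≡ e
  exact-cancel {f} {e} {x} {y} p@(exact o odd refl) q@(exact o′ odd′ eq)
    with m≤n⇒∃[o]m+o≡n (≮⇒≥ {e} {f} (λ e<f → exact-¬∣ q (∣-trans (2^-∣ e<f) (∣-trans (exact-∣ p) (m∣m*n y)))))
  ... | v , refl = v , exact-y (2^∣-odd-* {v} odd (divides o′ (trans oy≡ (*-comm (2 ^ v) o′)))) , refl
    where
    oy≡ : o * y ≡ 2 ^ v * o′
    oy≡ = *-cancelˡ-≡ (o * y) (2 ^ v * o′) (2 ^ f) {{m^n≢0 2 f}} (trans (sym (*-assoc (2 ^ f) o y))
      (trans eq (trans (cong (_* o′) (^-distribˡ-+-* 2 f v)) (*-assoc (2 ^ f) (2 ^ v) o′))))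
    exact-y : 2 ^ v ∣ y → Exact v y
    exact-y h = ∣-¬∣⇒exact {v} h (λ h′ → exact-¬∣ {v} (exact o′ odd′ refl)
      (subst (2 ^ suc v ∣_) oy≡ (∣n⇒∣m*n o h′)))

  -- Congruences between coefficient sequences

  infix 4 _≽[_]_

  -- A congruence modulo m that needs no subtraction.
  record _≽[_]_ (f : Coeffs) (m : ℕ) (g : Coeffs) : Set where
    constructor excess
    field
      quotient : Coeffs
      equation : ∀ k → f k ≡ g k + m * quotient k

  ≽-≗ : ∀ {m f g} → f ≗ g → f ≽[ m ] g
  ≽-≗ {m} {f} {g} eq = excess (λ _ → 0) λ k →
    trans (eq k) (sym (trans (cong (g k +_) (*-zeroʳ m)) (+-identityʳ _)))

  ≽-trans : ∀ {m f g h} → f ≽[ m ] g → g ≽[ m ] h → f ≽[ m ] h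
  ≽-trans {m} {h = h} (excess s p) (excess t q) = excess (λ k → t k + s k) λ k →
    trans (p k) (trans (cong (_+ m * s k) (q k)) (lem (h k) m (t k) (s k)))
    where lem : ∀ x m t s → x + m * t + m * s ≡ x + m * (t + s)
          lem = solve-∀

  L-≽ : ∀ {m a b f g} → (∃ λ c → a ≡ b + m * c) → f ≽[ m ] g → L a f ≽[ m ] L b g
  L-≽ {m} {a} {b} {f} {g} (c , refl) (excess s p) = excess s′ eq
    where
    s′ : Coeffs
    s′ zero    = b * s 0 + c * f 0
    s′ (suc k) = s k + b * s (suc k) + c * f (suc k)
    lem₀ : ∀ b c m x g s → x ≡ g + m * s → (b + m * c) * x ≡ b * g + m * (b * s + c * x)
    lem₀ b c m x g s refl = solve (b ∷ c ∷ m ∷ g ∷ s ∷ [])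
    lem₁ : ∀ b c m x g s y h t → x ≡ g + m * s → y ≡ h + m * t →
           y + (b + m * c) * x ≡ h + b * g + m * (t + b * s + c * x)
    lem₁ b c m x g s y h t refl refl = solve (b ∷ c ∷ m ∷ g ∷ s ∷ h ∷ t ∷ [])
    eq : ∀ k → L (b + m * c) f k ≡ L b g k + m * s′ k
    eq zero    = lem₀ b c m (f 0) (g 0) (s 0) (p 0)
    eq (suc k) = lem₁ b c m (f (suc k)) (g (suc k)) (s (suc k)) (f k) (g k) (s k) (p (suc k)) (p k)

  Prod-≽ : ∀ {m a b f g} n → (∀ j → j < n → ∃ λ c → a j ≡ b j + m * c) →
           f ≽[ m ] g → Prod a n f ≽[ m ] Prod b n g
  Prod-≽ zero    h p = p
  Prod-≽ (suc n) h p = L-≽ (h n ≤-refl) (Prod-≽ n (λ j j<n → h j (m≤n⇒m≤1+n j<n)) p)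

  -- (g + 2ms)² = g² + 4mgs + 4m²s², so squaring doubles an even modulus.
  conv-square-≽ : ∀ {m f g} → f ≽[ 2 * m ] g → conv f f ≽[ 2 * (2 * m) ] conv g g
  conv-square-≽ {m} {f} {g} (excess s p) =
    excess (λ k → conv s g k + m * conv s s k) λ k → begin
      conv f f k                              ≡⟨ conv-cong p p k ⟩
      conv f′ f′ k                            ≡⟨ conv-+ʳ f′ g s (2 * m) k ⟩
      conv f′ g k + 2 * m * conv f′ s k       ≡⟨ cong₂ (λ x y → x + 2 * m * y) (conv-comm f′ g k) (conv-comm f′ s k) ⟩
      conv g f′ k + 2 * m * conv s f′ k
        ≡⟨ cong₂ (λ x y → x + 2 * m * y) (conv-+ʳ g g s (2 * m) k) (conv-+ʳ s g s (2 * m) k) ⟩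
      conv g g k + 2 * m * conv g s k + 2 * m * (conv s g k + 2 * m * conv s s k)
        ≡⟨ cong (λ x → conv g g k + 2 * m * x + 2 * m * (conv s g k + 2 * m * conv s s k)) (conv-comm g s k) ⟩
      conv g g k + 2 * m * conv s g k + 2 * m * (conv s g k + 2 * m * conv s s k)
        ≡⟨ lem (conv g g k) m (conv s g k) (conv s s k) ⟩
      conv g g k + 2 * (2 * m) * (conv s g k + m * conv s s k) ∎
    where
    open ≡-Reasoning
    f′ : Coeffs
    f′ k = g k + 2 * m * s k
    lem : ∀ x m y z → x + 2 * m * y + 2 * m * (y + 2 * m * z) ≡ x + 2 * (2 * m) * (y + m * z)
    lem = solve-∀

  -- Parity of binomial coefficients

  bin : ℕ → Coeffs
  bin n = Prod (λ _ → 1) n δ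

  bin-0 : ∀ n → bin n 0 ≡ 1
  bin-0 zero    = refl
  bin-0 (suc n) rewrite bin-0 n = refl

  -- Absorption, by Pascal's rule. Every divisibility of binomial coefficients used below comes from
  -- it.
  bin-absorb : ∀ n k → suc k * bin (suc n) (suc k) ≡ suc n * bin n k
  bin-absorb zero    zero    = refl
  bin-absorb zero    (suc k) = *-zeroʳ (suc (suc k))
  bin-absorb (suc n) zero    = begin
    1 * (bin (suc n) 0 + 1 * bin (suc n) 1)  ≡⟨ lem (bin (suc n) 0) (bin (suc n) 1) ⟩
    bin (suc n) 0 + 1 * bin (suc n) 1        ≡⟨ cong₂ _+_ (bin-0 (suc n)) (bin-absorb n 0) ⟩
    1 + suc n * bin n 0                      ≡⟨ cong (λ x → 1 + suc n * x) (bin-0 n) ⟩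
    1 + suc n * 1                            ≡⟨ cong (suc (suc n) *_) (sym (bin-0 (suc n))) ⟩
    suc (suc n) * bin (suc n) 0              ∎
    where
    open ≡-Reasoning
    lem : ∀ x y → 1 * (x + 1 * y) ≡ x + 1 * y
    lem = solve-∀
  bin-absorb (suc n) (suc k) = begin
    suc (suc k) * (b₁ + 1 * b₂)                          ≡⟨ lem k b₁ b₂ ⟩
    b₁ + (suc k * b₁ + suc (suc k) * b₂)
      ≡⟨ cong (b₁ +_) (cong₂ _+_ (bin-absorb n k) (bin-absorb n (suc k))) ⟩
    b₁ + (suc n * bin n k + suc n * bin n (suc k))       ≡⟨ lem′ n (bin n k) (bin n (suc k)) ⟩
    suc (suc n) * b₁                                     ∎
    where
    open ≡-Reasoning
    b₁ b₂ : ℕ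
    b₁ = bin (suc n) (suc k)
    b₂ = bin (suc n) (suc (suc k))
    lem : ∀ k x y → suc (suc k) * (x + 1 * y) ≡ x + (suc k * x + suc (suc k) * y)
    lem = solve-∀
    lem′ : ∀ n x y → x + 1 * y + (suc n * x + suc n * y) ≡ suc (suc n) * (x + 1 * y)
    lem′ = solve-∀

  2^-suc-pred : ∀ a → ∃ λ t → 2 ^ a ≡ suc t
  2^-suc-pred a with 2 ^ a | 2^-pos a
  ... | suc t | _ = t , refl

  -- If the entry were odd, absorption would make 2ᵃ divide k, which is positive and too small.
  bin-2^-even : ∀ a k → 0 < k → k < 2 ^ a → 2 ∣ bin (2 ^ a) k
  bin-2^-even a (suc k) _ k<2^a with 2^-suc-pred a | even-or-odd (bin (2 ^ a) (suc k))
  ... | _      | inj₁ even = even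
  ... | t , eq | inj₂ odd  = ⊥-elim (<⇒≱ k<2^a (∣⇒≤ (2^∣-odd-* {a} odd (subst (2 ^ a ∣_)
          (trans (sym absorb) (*-comm (suc k) _)) (m∣m*n (bin t k))))))
    where
    absorb : suc k * bin (2 ^ a) (suc k) ≡ 2 ^ a * bin t k
    absorb rewrite eq = bin-absorb t k

  -- Neighbours in row 2ᵃ - 1 add up to an inner entry of row 2ᵃ, which is even; hence the parity of
  -- the entry 1 at index 0 passes along the row.
  bin-2^∸1-odd : ∀ a t k → 2 ^ a ≡ suc t → k < 2 ^ a → Odd (bin t k)
  bin-2^∸1-odd a t zero    eq k< = 0 , bin-0 t
  bin-2^∸1-odd a t (suc k) eq k< with even-or-odd (bin t (suc k))
  ... | inj₂ odd  = odd
  ... | inj₁ even = ⊥-elim (odd⇒¬2∣ (odd-+even (bin-2^∸1-odd a t k eq (<⇒≤ k<)) (∣n⇒∣m*n 1 even))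
          (subst (λ n → 2 ∣ bin n (suc k)) eq (bin-2^-even a (suc k) (s≤s z≤n) k<)))

  -- The factors with odd index: R modulo a power of two

  -- With 4K = 2ⁿ these are the constants of the factors of P with odd index.
  β : ℕ → ℕ → ℕ
  β K j = (1 + 2 * j) * (4 * K ∸ (1 + 2 * j))

  R : ℕ → Coeffs
  R a = Prod (β (2 ^ a)) (2 ^ a) δ

  4K∸odd : ∀ i q → 4 * (suc i + q) ∸ (1 + 2 * i) ≡ 1 + 2 * (suc i + q + q)
  4K∸odd i q = trans (cong (_∸ (1 + 2 * i)) (lem i q)) (m+n∸n≡m _ (1 + 2 * i))
    where lem : ∀ i q → 4 * (1 + i + q) ≡ 1 + 2 * (1 + i + q + q) + (1 + 2 * i)
          lem = solve-∀

  -- With o = 1 + 2j, o(8K - o) = o(4K - o) + 4K · o.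
  β-lower-half : ∀ K j → j < K → ∃ λ c → β (2 * K) j ≡ β K j + 4 * K * c
  β-lower-half K j j<K with m≤n⇒∃[o]m+o≡n j<K
  ... | q , refl = 1 + 2 * j , trans (cong ((1 + 2 * j) *_) eq)
          (trans (lem (1 + 2 * j) (4 * (suc j + q)) _)
            (cong (λ x → (1 + 2 * j) * x + 4 * (suc j + q) * (1 + 2 * j)) (sym (4K∸odd j q))))
    where
    eq : 4 * (2 * (suc j + q)) ∸ (1 + 2 * j) ≡ 4 * (suc j + q) + (1 + 2 * (suc j + q + q))
    eq = trans (cong (_∸ (1 + 2 * j)) (lem′ j q)) (m+n∸n≡m _ (1 + 2 * j))
      where lem′ : ∀ i q → 4 * (2 * (1 + i + q)) ≡ 4 * (1 + i + q) + (1 + 2 * (1 + i + q + q)) + (1 + 2 * i)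
            lem′ = solve-∀
    lem : ∀ o k r → o * (k + r) ≡ o * r + k * o
    lem = solve-∀

  -- With o = 1 + 2j, the odd number at the mirrored index is r = 4K - o, and r(8K - r) = r(4K + o)
  -- = o(4K - o) + 4K · r.
  β-upper-half : ∀ K j → j < K → ∃ λ c → β (2 * K) (K + (K ∸ suc j)) ≡ β K j + 4 * K * c
  β-upper-half K j j<K with m≤n⇒∃[o]m+o≡n j<K
  ... | q , refl rewrite m+n∸m≡n j q | 4K∸odd j q =
    r , trans (cong (r *_) eq) (lem (1 + 2 * j) (4 * (suc j + q)) r)
    where
    r : ℕ
    r = 1 + 2 * (suc j + q + q)
    eq : 4 * (2 * (suc j + q)) ∸ r ≡ 4 * (suc j + q) + (1 + 2 * j)
    eq = trans (cong (_∸ r) (lem′ j q)) (m+n∸n≡m _ r)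
      where lem′ : ∀ i q → 4 * (2 * (1 + i + q)) ≡ 4 * (1 + i + q) + (1 + 2 * i) + (1 + 2 * (1 + i + q + q))
            lem′ = solve-∀
    lem : ∀ o k r → r * (k + o) ≡ o * r + k * r
    lem = solve-∀

  -- Modulo 4 · 2ᵃ, the lower half of the product `R (suc a)` and its upper half read backwards both
  -- have the constants of `R a`, so `R (suc a)` is congruent to the square of `R a`. Squaring the
  -- induction hypothesis yields the same doubled modulus.
  R≽bin : ∀ a → R a ≽[ 2 * 2 ^ a ] bin (2 ^ a)
  -- `R 0` is X + 3, which exceeds X + 1 by the modulus 2 at index 0 only.
  R≽bin zero    = excess δ λ { zero → refl ; (suc zero) → refl ; (suc (suc k)) → refl }
  R≽bin (suc a) =
    ≽-trans {g = conv (R a) (R a)} R-square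
      (≽-trans {g = conv (bin K) (bin K)} (conv-square-≽ {K} (R≽bin a)) (≽-≗ bin-square))
    where
    K : ℕ
    K = 2 ^ a
    2K≡ : 2 * K ≡ K + K
    2K≡ = cong (K +_) (+-identityʳ K)
    split : ∀ f → Prod f (2 * K) δ ≗ Prod (λ j → f (K + j)) K (Prod f K δ)
    split f k rewrite 2K≡ = Prod-+ f K K δ k
    bin-square : conv (bin K) (bin K) ≗ bin (2 * K)
    bin-square k = sym (trans (split (λ _ → 1) k) (conv-Prod (λ _ → 1) K (bin K) k))
    R-square : R (suc a) ≽[ 2 * (2 * K) ] conv (R a) (R a)
    R-square = subst (λ m → R (suc a) ≽[ m ] conv (R a) (R a)) (*-assoc 2 2 K)
      (≽-trans (≽-≗ (λ k → trans (split (β (2 * K)) k)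
                        (Prod-reverse (λ j → β (2 * K) (K + j)) K (Prod (β (2 * K)) K δ) k)))
        (≽-trans (Prod-≽ K (β-upper-half K) (Prod-≽ K (β-lower-half K) (≽-≗ (λ _ → refl))))
          (≽-≗ (conv-Prod (β K) K (R a)))))

  2∣R : ∀ a k → 0 < k → k < 2 ^ a → 2 ∣ R a k
  2∣R a k 0<k k< with R≽bin a
  ... | excess s eq = subst (2 ∣_) (sym (eq k))
    (∣m∣n⇒∣m+n (bin-2^-even a k 0<k k<) (∣-trans (m∣m*n (2 ^ a)) (m∣m*n (s k))))

  R-0-odd : ∀ a → Odd (R a 0)
  R-0-odd a with R≽bin a
  ... | excess s eq = subst Odd (sym (eq 0))
    (odd-+even (0 , bin-0 (2 ^ a)) (∣-trans (m∣m*n (2 ^ a)) (m∣m*n (s 0))))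

  -- Absorption supplies 2ᵃ times an entry of row 2ᵃ - 1, and the error in `R≽bin` carries one more
  -- factor 2, so the parity of the cofactor is that of the binomial.
  k*R : ∀ a k → ∃ λ t → ∃ λ s → 2 ^ a ≡ suc t × suc k * R a (suc k) ≡ 2 ^ a * (bin t k + 2 * s)
  k*R a k with R≽bin a | 2^-suc-pred a
  ... | excess s eq | t , eq′ = t , suc k * s (suc k) , eq′ , (begin
    suc k * R a (suc k)                                                ≡⟨ cong (suc k *_) (eq (suc k)) ⟩
    suc k * (bin (2 ^ a) (suc k) + 2 * 2 ^ a * s (suc k))              ≡⟨ lem (suc k) (bin (2 ^ a) (suc k)) (2 ^ a) (s (suc k)) ⟩
    suc k * bin (2 ^ a) (suc k) + 2 ^ a * (2 * (suc k * s (suc k)))    ≡⟨ cong (_+ 2 ^ a * (2 * (suc k * s (suc k)))) absorb ⟩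
    2 ^ a * bin t k + 2 ^ a * (2 * (suc k * s (suc k)))                ≡⟨ *-distribˡ-+ (2 ^ a) (bin t k) _ ⟨
    2 ^ a * (bin t k + 2 * (suc k * s (suc k)))                        ∎)
    where
    open ≡-Reasoning
    lem : ∀ k b p s → k * (b + 2 * p * s) ≡ k * b + p * (2 * (k * s))
    lem = solve-∀
    absorb : suc k * bin (2 ^ a) (suc k) ≡ 2 ^ a * bin t k
    absorb rewrite eq′ = bin-absorb t k

  2^∣k*R : ∀ a k → 2 ^ a ∣ k * R a k
  2^∣k*R a zero    = (2 ^ a) ∣0
  2^∣k*R a (suc k) with k*R a k
  ... | t , s , _ , eq = subst (2 ^ a ∣_) (sym eq) (m∣m*n _)

  k*R-exact : ∀ a k → 0 < k → k ≤ 2 ^ a → Exact a (k * R a k)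
  k*R-exact a (suc k) _ k< with k*R a k
  ... | t , s , eq′ , eq = exact (bin t k + 2 * s) (odd-+even (bin-2^∸1-odd a t k eq′ k<) (m∣m*n s)) eq

  -- The binary logarithm and the convex function χ

  lg : ℕ → ℕ
  lg zero = 0
  lg (suc c) with suc c ≟ 2 ^ suc (lg c)
  ... | yes _ = suc (lg c)
  ... | no  _ = lg c

  lg-step : ∀ c →
    (suc c ≡ 2 ^ suc (lg c) × lg (suc c) ≡ suc (lg c)) ⊎ (suc c ≢ 2 ^ suc (lg c) × lg (suc c) ≡ lg c)
  lg-step c with suc c ≟ 2 ^ suc (lg c)
  ... | yes p = inj₁ (p , refl)
  ... | no ¬p = inj₂ (¬p , refl)

  2^-suc-< : ∀ a → 2 ^ a < 2 ^ suc a
  2^-suc-< a = ^-monoʳ-< 2 ≤-refl (n<1+n a)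

  lg-bounds : ∀ c → 0 < c → 2 ^ lg c ≤ c × c < 2 ^ suc (lg c)
  lg-bounds (suc zero)    _ = s≤s z≤n , s≤s (s≤s z≤n)
  lg-bounds (suc (suc c)) _ with lg-step (suc c) | lg-bounds (suc c) (s≤s z≤n)
  ... | inj₁ (p  , eq) | lo , hi rewrite eq =
    ≤-reflexive (sym p) , subst (_< 2 ^ suc (suc (lg (suc c)))) (sym p) (2^-suc-< (suc (lg (suc c))))
  ... | inj₂ (¬p , eq) | lo , hi rewrite eq = m≤n⇒m≤1+n lo , ≤∧≢⇒< hi ¬p

  2^-cancel-< : ∀ {a b} → 2 ^ a < 2 ^ b → a < b
  2^-cancel-< {a} {b} p = ≰⇒> (λ b≤a → <⇒≱ p (^-monoʳ-≤ 2 b≤a))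

  lg-< : ∀ a c → 0 < c → c < 2 ^ a → lg c < a
  lg-< a c 0<c c< = 2^-cancel-< (≤-<-trans (proj₁ (lg-bounds c 0<c)) c<)

  lg-unique : ∀ b c → 2 ^ b ≤ c → c < 2 ^ suc b → lg c ≡ b
  lg-unique b c lo hi = ≤-antisym (s≤s⁻¹ (lg-< (suc b) c 0<c hi))
    (s≤s⁻¹ (2^-cancel-< {b} {suc (lg c)} (≤-<-trans lo (proj₂ (lg-bounds c 0<c)))))
    where 0<c = ≤-trans (2^-pos b) lo

  χ : ℕ → ℕ
  χ zero          = 0
  χ (suc zero)    = 0
  χ (suc (suc c)) = χ (suc c) + 2 * (lg (suc c) + 2)

  χ-suc : ∀ c → 0 < c → χ (suc c) ≡ χ c + 2 * (lg c + 2)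
  χ-suc (suc c) _ = refl

  χ-closed : ∀ c → 0 < c → χ c + 4 * 2 ^ lg c ≡ 2 * (lg c + 2) * c
  χ-closed (suc zero)    _ = refl
  χ-closed (suc (suc c)) _ with lg-step (suc c) | χ-closed (suc c) (s≤s z≤n)
  ... | inj₂ (_ , eq) | ih rewrite eq =
    trans (lem (χ (suc c)) (2 * (lg (suc c) + 2)) (4 * 2 ^ lg (suc c)))
      (trans (cong (_+ 2 * (lg (suc c) + 2)) ih) (lem′ (2 * (lg (suc c) + 2)) (suc c)))
    where lem : ∀ x y w → x + y + w ≡ x + w + y
          lem = solve-∀
          lem′ : ∀ y c → y * c + y ≡ y * suc c
          lem′ = solve-∀
  -- At a new power of two, 4 · 2ᵇ grows by twice that power, which is what the increase of the
  -- coefficient 2(b + 2) by 2 adds on the right.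
  ... | inj₁ (p , eq) | ih rewrite eq =
    trans (lem (χ (suc c)) (lg (suc c)) (2 ^ lg (suc c)))
      (trans (cong₂ (λ x y → x + 2 * (lg (suc c) + 2) + 2 * y) ih (sym p)) (lem′ (lg (suc c)) (suc c)))
    where lem : ∀ x l w → x + 2 * (l + 2) + 4 * (2 * w) ≡ x + 4 * w + 2 * (l + 2) + 2 * (2 * w)
          lem = solve-∀
          lem′ : ∀ l c → 2 * (l + 2) * c + 2 * (l + 2) + 2 * suc c ≡ 2 * (suc l + 2) * suc c
          lem′ = solve-∀

  χ-mono : ∀ c d → 0 < c → χ c ≤ χ (c + d)
  χ-mono c zero    0<c = ≤-reflexive (cong χ (sym (+-identityʳ c)))
  χ-mono c (suc d) 0<c rewrite +-suc c d | χ-suc (c + d) (≤-trans 0<c (m≤m+n c d)) =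
    ≤-trans (χ-mono c d 0<c) (m≤m+n _ _)

  -- Of the two spare units, one makes the domination in `stirling1-exact` strict and the other pays
  -- for the factor 2 in `u-∣`.
  χ-gap : ∀ c d → 0 < c → c < d → χ c + lg c + 2 ≤ χ d
  χ-gap c d 0<c c<d with m≤n⇒∃[o]m+o≡n c<d
  ... | e , refl = ≤-trans le (χ-mono (suc c) e (s≤s z≤n))
    where
    lem : ∀ x l → x + 2 * (l + 2) ≡ x + l + 2 + (l + 2)
    lem = solve-∀
    le : χ c + lg c + 2 ≤ χ (suc c)
    le rewrite χ-suc c 0<c | lem (χ c) (lg c) = m≤m+n _ _

  -- Below 2ᵃ⁺¹ no slope of χ exceeds 2(a + 2), the exponent that `weight (suc a)` contributes per
  -- unit of the index.
  χ-growth : ∀ a d e → 0 < d → d + e ≤ 2 ^ suc a → χ (d + e) ≤ χ d + 2 * (a + 2) * e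
  χ-growth a d zero    0<d h rewrite +-identityʳ d = m≤m+n _ _
  χ-growth a d (suc e) 0<d h rewrite +-suc d e | χ-suc (d + e) (≤-trans 0<d (m≤m+n d e)) = begin
    χ (d + e) + 2 * (lg (d + e) + 2)
      ≤⟨ +-mono-≤ (χ-growth a d e 0<d (<⇒≤ h))
           (*-monoʳ-≤ 2 (+-monoˡ-≤ 2 (s≤s⁻¹ (lg-< (suc a) (d + e) (≤-trans 0<d (m≤m+n d e)) h)))) ⟩
    χ d + 2 * (a + 2) * e + 2 * (a + 2) ≡⟨ lem (χ d) (2 * (a + 2)) e ⟩
    χ d + 2 * (a + 2) * suc e ∎
    where
    open ≤-Reasoning
    lem : ∀ x y e → x + y * e + y ≡ x + y * suc e
    lem = solve-∀

  -- Below 2ᵃ the slope 2(lg c + 2) of χ leaves room for one step of lg and one unit more;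
  -- this unit is what makes the dominant summand of z-exact strictly dominant.
  χ+lg-step< : ∀ a c → 0 < c → c < 2 ^ a → suc (χ (suc c) + lg (suc c)) ≤ χ c + lg c + 2 * (a + 2)
  χ+lg-step< a c 0<c c< rewrite χ-suc c 0<c = begin
    suc (χ c + 2 * (lg c + 2) + lg (suc c))   ≤⟨ s≤s (+-monoʳ-≤ _ lg-suc≤) ⟩
    suc (χ c + 2 * (lg c + 2) + suc (lg c))   ≡⟨ lem (χ c) (lg c) ⟩
    χ c + lg c + 2 * (suc (lg c) + 2)         ≤⟨ +-monoʳ-≤ (χ c + lg c) (*-monoʳ-≤ 2 (+-monoˡ-≤ 2 (lg-< a c 0<c c<))) ⟩
    χ c + lg c + 2 * (a + 2)                  ∎
    where
    open ≤-Reasoning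
    lem : ∀ x l → suc (x + 2 * (l + 2) + suc l) ≡ x + l + 2 * (suc l + 2)
    lem = solve-∀
    lg-suc≤ : lg (suc c) ≤ suc (lg c)
    lg-suc≤ with lg-step c
    ... | inj₁ (_ , eq) = ≤-reflexive eq
    ... | inj₂ (_ , eq) = ≤-trans (≤-reflexive eq) (n≤1+n _)

  -- A jump of `lg` below 2ᵃ⁺¹ occurs at 2ᵃ or earlier, where the strict estimate holds; without a
  -- jump only the slope matters.
  χ+lg-step : ∀ a c → 0 < c → suc c < 2 ^ suc a → χ (suc c) + lg (suc c) ≤ χ c + lg c + 2 * (a + 2)
  χ+lg-step a c 0<c c< with lg-step c
  ... | inj₂ (_ , eq) rewrite χ-suc c 0<c | eq = begin
    χ c + 2 * (lg c + 2) + lg c  ≡⟨ lem (χ c) (lg c) (2 * (lg c + 2)) ⟩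
    χ c + lg c + 2 * (lg c + 2)
      ≤⟨ +-monoʳ-≤ (χ c + lg c) (*-monoʳ-≤ 2 (+-monoˡ-≤ 2 (s≤s⁻¹ (lg-< (suc a) c 0<c (<⇒≤ c<))))) ⟩
    χ c + lg c + 2 * (a + 2)     ∎
    where
    open ≤-Reasoning
    lem : ∀ x l y → x + y + l ≡ x + l + y
    lem = solve-∀
  ... | inj₁ (p , eq) = <⇒≤ (χ+lg-step< a c 0<c (<-≤-trans (proj₂ (lg-bounds c 0<c))
    (^-monoʳ-≤ 2 (s≤s⁻¹ (subst (_< suc a) eq (lg-< (suc a) (suc c) (s≤s z≤n) c<))))))

  -- The first step starts below 2ᵃ and gains the unit of strictness; the later ones preserve it.
  χ+lg-growth : ∀ a d e → 0 < d → d < 2 ^ a → d + suc e < 2 ^ suc a →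
    suc (χ (d + suc e) + lg (d + suc e)) ≤ χ d + lg d + 2 * (a + 2) * suc e
  χ+lg-growth a d zero 0<d d< h rewrite +-comm d 1 | *-identityʳ (2 * (a + 2)) = χ+lg-step< a d 0<d d<
  χ+lg-growth a d (suc e) 0<d d< h rewrite +-suc d (suc e) = begin
    suc (χ (suc (d + suc e)) + lg (suc (d + suc e)))  ≤⟨ s≤s (χ+lg-step a (d + suc e) (≤-trans 0<d (m≤m+n d _)) h) ⟩
    suc (χ (d + suc e) + lg (d + suc e)) + 2 * (a + 2)  ≤⟨ +-monoˡ-≤ _ (χ+lg-growth a d e 0<d d< (<⇒≤ h)) ⟩
    χ d + lg d + 2 * (a + 2) * suc e + 2 * (a + 2)      ≡⟨ lem (χ d + lg d) (2 * (a + 2)) (suc e) ⟩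
    χ d + lg d + 2 * (a + 2) * suc (suc e)              ∎
    where
    open ≤-Reasoning
    lem : ∀ x y e → x + y * e + y ≡ x + y * suc e
    lem = solve-∀

  -- Valuations of the coefficients of P

  α : ℕ → ℕ → ℕ
  α N j = j * (N ∸ j)

  -- Indexed by a = n − 1.
  P : ℕ → Coeffs
  P a = Prod (α (2 ^ suc a)) (2 ^ a) δ

  Prod-zero : ∀ a n f → a 0 ≡ 0 → 0 < n → Prod a n f 0 ≡ 0
  Prod-zero a (suc zero)    f eq _ rewrite eq = refl
  Prod-zero a (suc (suc n)) f eq _ rewrite Prod-zero a (suc n) f eq (s≤s z≤n) = *-zeroʳ (a (suc n))

  P-suc : ∀ a → P (suc a) ≗ conv (Prod (λ j → 4 * α (2 ^ suc a) j) (2 ^ a) δ) (R a)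
  P-suc a k = begin
    Prod (α (2 ^ suc (suc a))) (2 * K) δ k     ≡⟨ Prod-evens-odds (α (2 ^ suc (suc a))) K δ k ⟩
    Prod (λ j → α (2 ^ suc (suc a)) (1 + 2 * j)) K (Prod (λ j → α (2 ^ suc (suc a)) (2 * j)) K δ) k
      ≡⟨ Prod-cong K (λ j _ → odds j) (Prod-cong K (λ j _ → evens j) (λ _ → refl)) k ⟩
    Prod (β K) K A k                           ≡⟨ conv-Prod (β K) K A k ⟩
    conv (R a) A k                             ≡⟨ conv-comm (R a) A k ⟩
    conv A (R a) k                             ∎
    where
    open ≡-Reasoning
    K : ℕ
    K = 2 ^ a
    A : Coeffs
    A = Prod (λ j → 4 * α (2 ^ suc a) j) K δ
    odds : ∀ j → α (2 ^ suc (suc a)) (1 + 2 * j) ≡ β K j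
    odds j = cong (λ x → (1 + 2 * j) * (x ∸ (1 + 2 * j))) (sym (*-assoc 2 2 K))
    evens : ∀ j → α (2 ^ suc (suc a)) (2 * j) ≡ 4 * α (2 ^ suc a) j
    evens j = trans (cong (2 * j *_) (sym (*-distribˡ-∸ 2 (2 ^ suc a) j))) (lem j (2 ^ suc a ∸ j))
      where lem : ∀ j x → 2 * j * (2 * x) ≡ 4 * (j * x)
            lem = solve-∀

  ^-distribʳ-* : ∀ k x y → (x * y) ^ k ≡ x ^ k * y ^ k
  ^-distribʳ-* zero    x y = refl
  ^-distribʳ-* (suc k) x y rewrite ^-distribʳ-* k x y = lem x y (x ^ k) (y ^ k)
    where lem : ∀ x y u v → x * y * (u * v) ≡ x * u * (y * v)
          lem = solve-∀

  weight : ℕ → ℕ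
  weight a = 2 ^ (2 * suc a)

  z : ℕ → Coeffs
  z a c = weight a ^ c * P a c

  z-0 : ∀ a → z a 0 ≡ 0
  z-0 a rewrite Prod-zero (α (2 ^ suc a)) (2 ^ a) δ refl (2^-pos a) = refl

  z-degree : ∀ a c → 2 ^ a < c → z a c ≡ 0
  z-degree a c lt rewrite Prod-degree (α (2 ^ suc a)) (2 ^ a) c lt = *-zeroʳ (weight a ^ c)

  -- The weight grows by a factor 4 per unit of the index, and the constants of the even-indexed
  -- factors carry a 4 each. By homogeneity the two combine into the single constant 4^(2ᵃ).
  z-suc : ∀ a c → z (suc a) c ≡ conv (λ d → 2 ^ (2 * 2 ^ a) * z a d) (λ e → weight (suc a) ^ e * R a e) c
  z-suc a c = trans (cong (weight (suc a) ^ c *_) (P-suc a c))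
    (trans (conv-weight (weight (suc a)) A (R a) c) (conv-cong scale (λ _ → refl) c))
    where
    A : Coeffs
    A = Prod (λ j → 4 * α (2 ^ suc a) j) (2 ^ a) δ
    weight-suc : weight (suc a) ≡ weight a * 4
    weight-suc = trans (cong (2 ^_) (trans (*-suc 2 (suc a)) (+-comm 2 (2 * suc a))))
      (^-distribˡ-+-* 2 (2 * suc a) 2)
    scale : ∀ d → weight (suc a) ^ d * A d ≡ 2 ^ (2 * 2 ^ a) * z a d
    scale d = begin
      weight (suc a) ^ d * A d          ≡⟨ cong (λ w → w ^ d * A d) weight-suc ⟩
      (weight a * 4) ^ d * A d          ≡⟨ cong (_* A d) (^-distribʳ-* d (weight a) 4) ⟩
      weight a ^ d * 4 ^ d * A d        ≡⟨ *-assoc (weight a ^ d) (4 ^ d) (A d) ⟩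
      weight a ^ d * (4 ^ d * A d)      ≡⟨ cong (weight a ^ d *_) (Prod-scale 4 (α (2 ^ suc a)) (2 ^ a) d) ⟩
      weight a ^ d * (4 ^ 2 ^ a * P a d) ≡⟨ cong (λ x → weight a ^ d * (x * P a d)) (^-*-assoc 2 2 (2 ^ a)) ⟩
      weight a ^ d * (2 ^ (2 * 2 ^ a) * P a d) ≡⟨ lem (weight a ^ d) (2 ^ (2 * 2 ^ a)) (P a d) ⟩
      2 ^ (2 * 2 ^ a) * (weight a ^ d * P a d) ∎
      where
      open ≡-Reasoning
      lem : ∀ x y z → x * (y * z) ≡ y * (x * z)
      lem = solve-∀

  weight-^ : ∀ a e → weight (suc a) ^ e ≡ 2 ^ (2 * (a + 2) * e)
  weight-^ a e = trans (^-*-assoc 2 (2 * suc (suc a)) e) (cong (λ x → 2 ^ (2 * x * e)) (+-comm 2 a))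

  ∣-*-mono : ∀ {a b c d} → a ∣ b → c ∣ d → a * c ∣ b * d
  ∣-*-mono {a} {b} {c} {d} p q = ∣-trans (*-monoˡ-∣ c p) (*-monoʳ-∣ b q)

  2^-∣-* : ∀ {e f x y} → 2 ^ e ∣ x → 2 ^ f ∣ y → 2 ^ (e + f) ∣ x * y
  2^-∣-* {e} {f} p q = subst (_∣ _) (sym (^-distribˡ-+-* 2 e f)) (∣-*-mono p q)

  ∣-≡0 : ∀ {t x} → x ≡ 0 → t ∣ x
  ∣-≡0 {t} refl = t ∣0

  -- The Newton polygon bound: it holds at every index without the multiplier c, because moving from
  -- d to d + e costs at least as much weight as χ grows.
  z-∣ : ∀ a c → 2 ^ (2 ^ suc a + χ c) ∣ z a c
  z-∣ a zero rewrite z-0 a = _ ∣0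
  z-∣ zero (suc zero)    = ∣-refl
  z-∣ zero (suc (suc c)) rewrite z-degree 0 (suc (suc c)) (s≤s (s≤s z≤n)) = _ ∣0
  z-∣ (suc a) c@(suc _) with c ≤? 2 ^ suc a
  ... | no c≰ rewrite z-degree (suc a) c (≰⇒> c≰) = _ ∣0
  ... | yes c≤ = subst (2 ^ (2 ^ suc (suc a) + χ c) ∣_) (trans (+-identityʳ _) (sym (z-suc a c)))
    (conv-∣ 1 f g c term)
    where
    f g : Coeffs
    f d = 2 ^ (2 * 2 ^ a) * z a d
    g e = weight (suc a) ^ e * R a e
    term : ∀ d e → d + e ≡ c → 2 ^ (2 ^ suc (suc a) + χ c) ∣ 1 * (f d * g e)
    term zero      e eq rewrite z-0 a | *-zeroʳ (2 ^ (2 * 2 ^ a)) = _ ∣0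
    term d@(suc _) e refl = ∣n⇒∣m*n 1 (∣-trans (2^-∣ bound)
      (2^-∣-* {2 * 2 ^ a + (2 ^ suc a + χ d)} {2 * (a + 2) * e}
        (2^-∣-* {2 * 2 ^ a} ∣-refl (z-∣ a d))
        (∣m⇒∣m*n (R a e) (∣-reflexive (sym (weight-^ a e))))))
      where
      lem : ∀ x y w → x + (x + y) + w ≡ x + (x + 0) + (y + w)
      lem = solve-∀
      bound : 2 ^ suc (suc a) + χ c ≤ 2 * 2 ^ a + (2 ^ suc a + χ d) + 2 * (a + 2) * e
      bound rewrite lem (2 ^ suc a) (χ d) (2 * (a + 2) * e) =
        +-monoʳ-≤ (2 ^ suc (suc a)) (χ-growth a d e (s≤s z≤n) c≤)

  -- P is monic, so the weighted leading coefficient is a pure power of two. The top index is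
  -- treated apart because `lg` has already jumped there, outside the range of `χ+lg-growth`.
  z-exact-leading : ∀ a → Exact (2 ^ suc a + χ (2 ^ a) + lg (2 ^ a)) (2 ^ a * z a (2 ^ a))
  z-exact-leading a = subst₂ Exact eq eq′ (exact-* (exact-2^ a) (exact-2^ (2 * suc a * 2 ^ a)))
    where
    lg≡a : lg (2 ^ a) ≡ a
    lg≡a = lg-unique a (2 ^ a) ≤-refl (2^-suc-< a)
    eq′ : 2 ^ a * 2 ^ (2 * suc a * 2 ^ a) ≡ 2 ^ a * z a (2 ^ a)
    eq′ rewrite Prod-leading (α (2 ^ suc a)) (2 ^ a) = cong (2 ^ a *_)
      (trans (sym (^-*-assoc 2 (2 * suc a) (2 ^ a))) (sym (*-identityʳ _)))
    closed : χ (2 ^ a) + 4 * 2 ^ a ≡ 2 * (a + 2) * 2 ^ a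
    closed = trans (cong (λ l → χ (2 ^ a) + 4 * 2 ^ l) (sym lg≡a))
      (trans (χ-closed (2 ^ a) (2^-pos a)) (cong (λ l → 2 * (l + 2) * 2 ^ a) lg≡a))
    eq : a + 2 * suc a * 2 ^ a ≡ 2 ^ suc a + χ (2 ^ a) + lg (2 ^ a)
    eq rewrite lg≡a = +-cancelˡ-≡ (2 * 2 ^ a) _ _
      (trans (lem a (2 ^ a)) (trans (cong (_+ a) (sym closed)) (lem′ (χ (2 ^ a)) (2 ^ a) a)))
      where lem : ∀ a p → 2 * p + (a + 2 * suc a * p) ≡ 2 * (a + 2) * p + a
            lem = solve-∀
            lem′ : ∀ x p a → x + 4 * p + a ≡ 2 * p + (2 * p + x + a)
            lem′ = solve-∀

  z-exact : ∀ a c → 0 < c → c ≤ 2 ^ a → Exact (2 ^ suc a + χ c + lg c) (c * z a c)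
  z-exact a c 0<c c≤ with c ≟ 2 ^ a
  z-exact a       c 0<c c≤ | yes refl = z-exact-leading a
  z-exact zero    (suc zero) 0<c c≤ | no c≢ = ⊥-elim (c≢ refl)
  z-exact zero    (suc (suc c)) 0<c (s≤s ()) | no c≢
  z-exact (suc a) c 0<c c≤ | no c≢ = subst (λ x → Exact T (c * x)) (sym (z-suc a c)) exact-conv
    where
    K T : ℕ
    K = 2 ^ a
    T = 2 ^ suc (suc a) + χ c + lg c
    f g : Coeffs
    f d = 2 ^ (2 * K) * z a d
    g e = weight (suc a) ^ e * R a e
    c<2K : c < 2 ^ suc a
    c<2K = ≤∧≢⇒< c≤ c≢

    minor : ∀ d e → d + e ≡ c → d < K → d ≢ c → 2 ^ suc T ∣ c * (f d * g e)
    minor zero e eq d<K d≢c rewrite z-0 a | *-zeroʳ (2 ^ (2 * K)) = ∣-≡0 (*-zeroʳ c)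
    minor d@(suc _) zero eq d<K d≢c = ⊥-elim (d≢c (trans (sym (+-identityʳ d)) eq))
    -- The product rule splits the multiplier d + e. The part with d `z a d` falls under the
    -- induction hypothesis; in the other, e `R a e` supplies 2ᵃ, more than 2^(lg d) since d < K.
    minor d@(suc _) e@(suc e′) refl d<K d≢c =
      subst (2 ^ suc T ∣_) (lem d e (2 ^ (2 * K)) (z a d) (weight (suc a) ^ e) (R a e))
        (∣-trans (2^-∣ bound) (2^-∣-* {2 * K + 2 * (a + 2) * e} {2 ^ suc a + χ d + lg d}
          (2^-∣-* {2 * K} ∣-refl (∣-reflexive (sym (weight-^ a e))))
          (∣m∣n⇒∣m+n
            (∣m⇒∣m*n (R a e) (exact-∣ (z-exact a d (s≤s z≤n) (<⇒≤ d<K))))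
            (∣-trans (2^-∣ (+-monoʳ-≤ (2 ^ suc a + χ d) (<⇒≤ (lg-< a d (s≤s z≤n) d<K))))
              (2^-∣-* {2 ^ suc a + χ d} (z-∣ a d) (2^∣k*R a e))))))
      where
      lem : ∀ d e p z w r → p * w * (d * z * r + z * (e * r)) ≡ (d + e) * (p * z * (w * r))
      lem = solve-∀
      bound : suc T ≤ 2 * K + 2 * (a + 2) * e + (2 ^ suc a + χ d + lg d)
      bound = subst₂ _≤_ (lem₁ (2 ^ suc (suc a)) (χ c) (lg c)) (lem₂ (2 * K) (χ d) (lg d) (2 * (a + 2) * e))
        (+-monoʳ-≤ (2 ^ suc (suc a)) (χ+lg-growth a d e′ (s≤s z≤n) d<K c<2K))
        where lem₁ : ∀ x y l → x + suc (y + l) ≡ suc (x + y + l)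
              lem₁ = solve-∀
              lem₂ : ∀ p x l w → 2 * p + (x + l + w) ≡ p + w + (p + x + l)
              lem₂ = solve-∀

    dominated-by : ∀ d₀ e₀ → d₀ + e₀ ≡ c → Exact T (c * (f d₀ * g e₀)) →
      (∀ d e → d + e ≡ c → d ≢ d₀ → 2 ^ suc T ∣ c * (f d * g e)) → Exact T (c * conv f g c)
    dominated-by d₀ e₀ eq main rest = helper eq
      (conv-dominant {2 ^ suc T} c f g d₀ e₀ (λ d e eq′ → rest d e (trans eq′ eq)))
      where
      helper : ∀ {k} → k ≡ c → (∃ λ u → c * conv f g k ≡ c * (f d₀ * g e₀) + 2 ^ suc T * u) →
               Exact T (c * conv f g c)
      helper refl (u , eq) = subst (Exact T) (sym eq) (exact-+ main (m∣m*n u))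

    low : c ≤ K → Exact T (c * conv f g c)
    low c≤K = dominated-by c 0 (+-identityʳ c)
      (subst₂ Exact (lem₁ (2 * K) (χ c) (lg c)) (lem₂ c (2 ^ (2 * K)) (z a c) (R a 0))
        (exact-* {2 * K + (2 ^ suc a + χ c + lg c)} {0}
          (exact-* (exact-2^ (2 * K)) (z-exact a c 0<c c≤K)) (exact-odd (R-0-odd a))))
      (λ d e eq d≢c → minor d e eq
        (<-≤-trans (≤∧≢⇒< (≤-trans (m≤m+n d e) (≤-reflexive eq)) d≢c) c≤K) d≢c)
      where lem₁ : ∀ p x l → p + (p + x + l) + 0 ≡ 2 * p + x + l
            lem₁ = solve-∀
            lem₂ : ∀ c p z r → p * (c * z) * r ≡ c * (p * z * (1 * r))
            lem₂ = solve-∀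

    high : ∀ e → 0 < e → K + e ≡ c → Exact T (c * conv f g c)
    high e 0<e eq = dominated-by K e eq
      (subst₂ Exact exponent (lem c (2 ^ (2 * K)) (z a K) (weight (suc a) ^ e) (R a e))
        (exact-* {2 * K + (2 * suc a * K + 2 * (a + 2) * e)} {a}
          (exact-* {2 * K} (exact-2^ (2 * K))
            (exact-* {2 * suc a * K} exact-z (subst (Exact _) (sym (weight-^ a e)) (exact-2^ (2 * (a + 2) * e)))))
          exact-r))
      rest
      where
      lem : ∀ c p z w r → p * (z * w) * (c * r) ≡ c * (p * z * (w * r))
      lem = solve-∀
      e<K : e < K
      e<K = +-cancelˡ-< K e K (subst₂ _<_ (sym eq) (cong (K +_) (+-identityʳ K)) c<2K)
      exact-z : Exact (2 * suc a * K) (z a K)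
      exact-z rewrite Prod-leading (α (2 ^ suc a)) (2 ^ a) =
        subst (Exact _) (trans (sym (^-*-assoc 2 (2 * suc a) K)) (sym (*-identityʳ _))) (exact-2^ (2 * suc a * K))
      -- Here c = e + K: e `R a e` has valuation exactly a, while `R a e` is even for 0 < e < K, so
      -- its multiple by K = 2ᵃ is divisible by 2ᵃ⁺¹.
      exact-r : Exact a (c * R a e)
      exact-r = subst (Exact a) (trans (lem′ e K (R a e)) (cong (_* R a e) eq))
        (exact-+ (k*R-exact a e 0<e (<⇒≤ e<K)) (subst (_∣ K * R a e) (*-comm K 2) (*-monoʳ-∣ K (2∣R a e 0<e e<K))))
        where lem′ : ∀ e k r → e * r + k * r ≡ (k + e) * r
              lem′ = solve-∀
      lg≡a : lg c ≡ a
      lg≡a = lg-unique a c (≤-trans (m≤m+n K e) (≤-reflexive eq)) c<2K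
      closed : χ c + 4 * K ≡ 2 * (a + 2) * (K + e)
      closed = trans (cong (λ l → χ c + 4 * 2 ^ l) (sym lg≡a))
        (trans (χ-closed c 0<c) (cong₂ (λ l x → 2 * (l + 2) * x) lg≡a (sym eq)))
      exponent : 2 * K + (2 * suc a * K + 2 * (a + 2) * e) + a ≡ T
      exponent = trans (lem₁ K a e) (trans (cong (_+ a) (sym closed))
        (trans (lem₂ (χ c) K a) (cong (2 ^ suc (suc a) + χ c +_) (sym lg≡a))))
        where lem₁ : ∀ K a e → 2 * K + (2 * suc a * K + 2 * (a + 2) * e) + a ≡ 2 * (a + 2) * (K + e) + a
              lem₁ = solve-∀
              lem₂ : ∀ x K a → x + 4 * K + a ≡ 2 * (2 * K) + x + a
              lem₂ = solve-∀
      rest : ∀ d e′ → d + e′ ≡ c → d ≢ K → 2 ^ suc T ∣ c * (f d * g e′)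
      rest d e′ eq′ d≢K with <-cmp d K
      ... | tri< d<K _ _ = minor d e′ eq′ d<K (<⇒≢ (<-≤-trans d<K (≤-trans (m≤m+n K e) (≤-reflexive eq))))
      ... | tri≈ _ d≡K _ = ⊥-elim (d≢K d≡K)
      ... | tri> _ _ K<d rewrite z-degree a d K<d | *-zeroʳ (2 ^ (2 * K)) = ∣-≡0 (*-zeroʳ c)

    exact-conv : Exact T (c * conv f g c)
    exact-conv with c ≤? K
    ... | yes c≤K = low c≤K
    ... | no  c≰K with m≤n⇒∃[o]m+o≡n (≰⇒> c≰K)
    ...   | e , eq = high (suc e) (s≤s z≤n) (trans (+-suc K e) eq)

  -- Stirling numbers as coefficient sequences, and finite sums

  coeff-⊕ : ∀ p q k → coeff (p ⊕ q) k ≡ coeff p k + coeff q k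
  coeff-⊕ []      q       k       = refl
  coeff-⊕ (a ∷ p) []      k       = sym (+-identityʳ _)
  coeff-⊕ (a ∷ p) (b ∷ q) zero    = refl
  coeff-⊕ (a ∷ p) (b ∷ q) (suc k) = coeff-⊕ p q k

  coeff-map-* : ∀ j p k → coeff (map (j *_) p) k ≡ j * coeff p k
  coeff-map-* j []      k       = sym (*-zeroʳ j)
  coeff-map-* j (a ∷ p) zero    = refl
  coeff-map-* j (a ∷ p) (suc k) = coeff-map-* j p k

  coeff-mulXplus : ∀ j p → coeff (mulXplus j p) ≗ L j (coeff p)
  coeff-mulXplus j p zero    = trans (coeff-⊕ (0 ∷ p) (map (j *_) p) 0) (coeff-map-* j p 0)
  coeff-mulXplus j p (suc k) =
    trans (coeff-⊕ (0 ∷ p) (map (j *_) p) (suc k)) (cong (coeff p k +_) (coeff-map-* j p (suc k)))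

  stirling1-Prod : ∀ n → stirling1 n ≗ Prod id n δ
  stirling1-Prod zero    zero    = refl
  stirling1-Prod zero    (suc k) = refl
  stirling1-Prod (suc n) k =
    trans (coeff-mulXplus n (risingAux n) k) (L-cong refl (stirling1-Prod n) k)

  ∑ : ℕ → (ℕ → ℕ) → ℕ
  ∑ zero    f = 0
  ∑ (suc n) f = ∑ n f + f n

  ∑-cong : ∀ {f g} n → f ≗ g → ∑ n f ≡ ∑ n g
  ∑-cong zero    p = refl
  ∑-cong (suc n) p = cong₂ _+_ (∑-cong n p) (p n)

  ∑-∣ : ∀ {t} m n f → (∀ c → c < n → t ∣ m * f c) → t ∣ m * ∑ n f
  ∑-∣ m zero f h = ∣-≡0 (*-zeroʳ m)
  ∑-∣ {t} m (suc n) f h = subst (t ∣_) (sym (*-distribˡ-+ m (∑ n f) (f n)))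
    (∣m∣n⇒∣m+n (∑-∣ m n f (λ c c<n → h c (m≤n⇒m≤1+n c<n))) (h n ≤-refl))

  ∑-exact : ∀ {e} m n f c₀ → c₀ < n → Exact e (m * f c₀) →
    (∀ c → c < n → c ≢ c₀ → 2 ^ suc e ∣ m * f c) → Exact e (m * ∑ n f)
  ∑-exact {e} m (suc n) f c₀ c₀< main rest with c₀ ≟ n
  ... | yes refl = subst (Exact e) (trans (+-comm (m * f n) _) (sym (*-distribˡ-+ m (∑ n f) (f n))))
          (exact-+ main (∑-∣ m n f (λ c c<n → rest c (m≤n⇒m≤1+n c<n) (<⇒≢ c<n))))
  ... | no c₀≢n  = subst (Exact e) (sym (*-distribˡ-+ m (∑ n f) (f n)))
          (exact-+ (∑-exact m n f c₀ (≤∧≢⇒< (s≤s⁻¹ c₀<) c₀≢n) main (λ c c<n → rest c (m≤n⇒m≤1+n c<n)))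
            (rest n ≤-refl (c₀≢n ∘ sym)))

  L-∑ : ∀ a n (q : Coeffs) (h : ℕ → Coeffs) →
    L a (λ k → ∑ n (λ c → q c * h c k)) ≗ λ k → ∑ n (λ c → q c * L a (h c) k)
  L-∑ a zero    q h zero    = *-zeroʳ a
  L-∑ a zero    q h (suc k) = *-zeroʳ a
  L-∑ a (suc n) q h zero    rewrite sym (L-∑ a n q h zero) = lem a _ (q n) (h n 0)
    where lem : ∀ a s q x → a * (s + q * x) ≡ a * s + q * (a * x)
          lem = solve-∀
  L-∑ a (suc n) q h (suc k) rewrite sym (L-∑ a n q h (suc k)) = lem a _ _ (q n) (h n k) (h n (suc k))
    where lem : ∀ a s t q x y → s + q * x + a * (t + q * y) ≡ s + a * t + q * (x + a * y)
          lem = solve-∀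

  -- If q is read as a polynomial in Y and the sum as the linear map sending Yᶜ to `u c`, then
  -- multiplication by Y becomes a shift of u.
  ∑-L : ∀ a n (q u : Coeffs) →
    ∑ (suc n) (λ c → L a q c * u c) ≡ ∑ n (λ c → q c * u (suc c)) + a * ∑ (suc n) (λ c → q c * u c)
  ∑-L a zero    q u = lem a (q 0) (u 0)
    where lem : ∀ a q u → 0 + a * q * u ≡ 0 + a * (0 + q * u)
          lem = solve-∀
  ∑-L a (suc n) q u = trans (cong (_+ L a q (suc n) * u (suc n)) (∑-L a n q u))
    (lem a (q n) (q (suc n)) (u (suc n)) (∑ n (λ c → q c * u (suc c))) (∑ (suc n) (λ c → q c * u c)))
    where lem : ∀ a q q′ u s t → s + a * t + (q + a * q′) * u ≡ s + q * u + a * (t + q′ * u)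
          lem = solve-∀

  -- Expansion of the rising factorial in powers of X(X + N)

  -- X(X + N) takes the place of X in the pairing of the factors X + j and X + (N ∸ j).
  L-pair : ∀ N j f → j ≤ N → ∀ k → L (N ∸ j) (L j f) k ≡ L N (L 0 f) k + α N j * f k
  L-pair N j f j≤N k with m≤n⇒∃[o]m+o≡n j≤N
  ... | r , refl rewrite m+n∸m≡n j r = go k
    where
    lem₀ : ∀ j r x → r * (j * x) ≡ (j + r) * (0 * x) + j * r * x
    lem₀ = solve-∀
    lem₁ : ∀ j r x y → j * x + r * (x + j * y) ≡ 0 * x + (j + r) * (x + 0 * y) + j * r * y
    lem₁ = solve-∀
    lem₂ : ∀ j r x y w → x + j * y + r * (y + j * w) ≡ x + 0 * y + (j + r) * (y + 0 * w) + j * r * w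
    lem₂ = solve-∀
    go : ∀ k → L r (L j f) k ≡ L (j + r) (L 0 f) k + j * r * f k
    go zero          = lem₀ j r (f 0)
    go (suc zero)    = lem₁ j r (f 0) (f 1)
    go (suc (suc k)) = lem₂ j r (f k) (f (suc k)) (f (suc (suc k)))

  module Expansion (K : ℕ) where

    N : ℕ
    N = 2 * K

    -- Coefficients of X(X + K)(X(X + N))ᶜ.
    u : ℕ → Coeffs
    u zero    = L K (L 0 δ)
    u (suc c) = L N (L 0 (u c))

    u-0 : ∀ c → u c 0 ≡ 0
    u-0 zero    = *-zeroʳ K
    u-0 (suc c) = *-zeroʳ N

    u-suc-1 : ∀ c → u (suc c) 1 ≡ N * u c 0
    u-suc-1 c = cong (N *_) (+-identityʳ (u c 0))

    u-suc-+2 : ∀ c j → u (suc c) (2 + j) ≡ u c j + N * u c (suc j)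
    u-suc-+2 c j = cong₂ _+_ (+-identityʳ (u c j)) (cong (N *_) (+-identityʳ (u c (suc j))))

    u-degree : ∀ c j → 2 + 2 * c < j → u c j ≡ 0
    u-degree zero (suc zero) (s≤s ())
    u-degree zero (suc (suc zero)) (s≤s (s≤s ()))
    u-degree zero (suc (suc (suc j))) _ = *-zeroʳ K
    u-degree (suc c) (suc (suc j)) (s≤s (s≤s h)) = trans (u-suc-+2 c j)
      (trans (cong₂ (λ x y → x + N * y) (u-degree c j h′) (u-degree c (suc j) (m≤n⇒m≤1+n h′))) (*-zeroʳ N))
      where
      h′ : 2 + 2 * c < j
      h′ = subst (_< j) (*-suc 2 c) h

    u-leading : ∀ c → u c (2 + 2 * c) ≡ 1
    u-leading zero = cong suc (*-zeroʳ K)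
    u-leading (suc c) rewrite *-suc 2 c = trans (u-suc-+2 c (2 + 2 * c))
      (cong₂ _+_ (u-leading c) (trans (cong (N *_) (u-degree c (3 + 2 * c) ≤-refl)) (*-zeroʳ N)))

    -- The constants of the linear factors add up to K + cN, and N = 2K.
    u-subleading : ∀ c → u c (1 + 2 * c) ≡ K * (1 + 2 * c)
    u-subleading zero = refl
    u-subleading (suc c) = trans (cong (λ j → u (suc c) (suc j)) (*-suc 2 c))
      (trans (u-suc-+2 c (1 + 2 * c))
        (trans (cong₂ (λ x y → x + N * y) (u-subleading c) (u-leading c)) (lem K c)))
      where lem : ∀ K c → K * (1 + 2 * c) + 2 * K * 1 ≡ K * (1 + 2 * suc c)
            lem = solve-∀

    -- Each X missing from a term of the expanded product is replaced by one of the constants 0, K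
    -- and N, and by K = N/2 at most once; the factor 2 makes up for that.
    u-∣ : ∀ c j k → j + k ≡ 2 + 2 * c → N ^ k ∣ 2 * u c j
    u-∣ c zero k eq rewrite u-0 c = (N ^ k) ∣0
    u-∣ zero (suc zero) (suc zero) eq = ∣-reflexive (lem K)
      where lem : ∀ K → 2 * K * 1 ≡ 2 * (0 + K * 1)
            lem = solve-∀
    u-∣ zero (suc (suc zero)) zero eq = 1∣ _
    u-∣ zero (suc (suc (suc j))) k ()
    u-∣ (suc c) (suc zero) (suc k) eq =
      ∣-≡0 (cong (2 *_) (trans (u-suc-1 c) (trans (cong (N *_) (u-0 c)) (*-zeroʳ N))))
    u-∣ (suc c) (suc (suc j)) zero eq = 1∣ _
    u-∣ (suc c) (suc (suc j)) (suc k) eq = subst (N ^ suc k ∣_)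
      (sym (trans (cong (2 *_) (u-suc-+2 c j)) (lem (u c j) N (u c (suc j)))))
      (∣m∣n⇒∣m+n (u-∣ c j (suc k) eq′) (*-monoʳ-∣ N (u-∣ c (suc j) k (trans (sym (+-suc j k)) eq′))))
      where
      eq′ : j + suc k ≡ 2 + 2 * c
      eq′ = suc-injective (suc-injective (trans eq (cong (2 +_) (*-suc 2 c))))
      lem : ∀ x n y → 2 * (x + n * y) ≡ 2 * x + n * (2 * y)
      lem = solve-∀

    pairs : ℕ → Coeffs
    pairs t = Prod (λ i → N ∸ suc i) t (Prod suc t (u 0))

    -- With Y = X(X + N), the next pair of factors is Y + α, so appending it multiplies a polynomial
    -- in Y by a linear factor.
    pairs-expansion : ∀ t → t ≤ N → pairs t ≗ λ k → ∑ (suc t) (λ c → Prod (λ i → α N (suc i)) t δ c * u c k)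
    pairs-expansion zero    _   k = sym (+-identityʳ _)
    pairs-expansion (suc t) t<N k = begin
      pairs (suc t) k
        ≡⟨ L-cong {N ∸ suc t} refl (Prod-L (λ i → N ∸ suc i) t (suc t) (Prod suc t (u 0))) k ⟩
      L (N ∸ suc t) (L (suc t) (pairs t)) k
        ≡⟨ L-cong {N ∸ suc t} refl (L-cong {suc t} refl ih) k ⟩
      L (N ∸ suc t) (L (suc t) S) k
        ≡⟨ L-pair N (suc t) S t<N k ⟩
      L N (L 0 S) k + αₜ * S k
        ≡⟨ cong (_+ αₜ * S k) (trans (L-cong {N} refl (L-∑ 0 (suc t) q u) k) (L-∑ N (suc t) q (L 0 ∘ u) k)) ⟩
      ∑ (suc t) (λ c → q c * u (suc c) k) + αₜ * S k
        ≡⟨ cong (λ x → ∑ (suc t) (λ c → q c * u (suc c) k) + αₜ * x) (sym top) ⟩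
      ∑ (suc t) (λ c → q c * u (suc c) k) + αₜ * ∑ (suc (suc t)) (λ c → q c * u c k)
        ≡⟨ ∑-L αₜ (suc t) q (λ c → u c k) ⟨
      ∑ (suc (suc t)) (λ c → L αₜ q c * u c k) ∎
      where
      open ≡-Reasoning
      αₜ : ℕ
      αₜ = α N (suc t)
      q S : Coeffs
      q = Prod (λ i → α N (suc i)) t δ
      S k = ∑ (suc t) (λ c → q c * u c k)
      ih : pairs t ≗ S
      ih = pairs-expansion t (<⇒≤ t<N)
      top : S k + q (suc t) * u (suc t) k ≡ S k
      top rewrite Prod-degree (λ i → α N (suc i)) t (suc t) ≤-refl = +-identityʳ _

    -- The factors X and X + K stay unpaired and form `u 0`; the other t = K - 1 factors below X + K
    -- meet those above it read backwards.
    stirling1-pairs : ∀ t → K ≡ suc t → stirling1 N ≗ pairs t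
    stirling1-pairs t refl k = begin
      stirling1 N k                                             ≡⟨ stirling1-Prod N k ⟩
      Prod id N δ k                                             ≡⟨ cong (λ n → Prod id n δ k) (cong (K +_) (+-identityʳ K)) ⟩
      Prod id (K + K) δ k                                       ≡⟨ Prod-+ id K K δ k ⟩
      Prod (K +_) K (Prod id K δ) k                             ≡⟨ Prod-+ (K +_) 1 t (Prod id K δ) k ⟩
      Prod (λ j → K + suc j) t (L (K + 0) (Prod id K δ)) k
        ≡⟨ Prod-cong t (λ _ _ → refl) (L-cong (+-identityʳ K) (Prod-+ id 1 t δ)) k ⟩
      Prod (λ j → K + suc j) t (L K (Prod suc t (L 0 δ))) k
        ≡⟨ Prod-cong t (λ _ _ → refl) (λ i → sym (Prod-L suc t K (L 0 δ) i)) k ⟩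
      Prod (λ j → K + suc j) t (Prod suc t (u 0)) k
        ≡⟨ Prod-reverse (λ j → K + suc j) t (Prod suc t (u 0)) k ⟩
      Prod (λ j → K + suc (t ∸ suc j)) t (Prod suc t (u 0)) k
        ≡⟨ Prod-cong t mirror (λ _ → refl) k ⟩
      pairs t k                                                 ∎
      where
      open ≡-Reasoning
      mirror : ∀ j → j < t → K + suc (t ∸ suc j) ≡ N ∸ suc j
      mirror j j<t with m≤n⇒∃[o]m+o≡n j<t
      ... | r , refl rewrite m+n∸m≡n j r =
        sym (trans (cong (_∸ j) (lem j r)) (m+n∸n≡m (suc (suc (j + r)) + suc r) j))
        where lem : ∀ j r → suc (j + r) + suc (suc (j + r) + 0) ≡ suc (suc (j + r)) + suc r + j
              lem = solve-∀

    stirling1-expansion : ∀ t → K ≡ suc t → ∀ i →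
      stirling1 N i ≡ ∑ K (λ c → Prod (α N) K δ (suc c) * u c i)
    stirling1-expansion t refl i = trans (stirling1-pairs t refl i)
      (trans (pairs-expansion t (≤-trans (n≤1+n t) (m≤m+n K (K + 0))) i)
        (∑-cong K (λ c → cong (_* u c i) (sym (shift c)))))
      where
      shift : ∀ c → Prod (α N) K δ (suc c) ≡ Prod (λ i → α N (suc i)) t δ c
      shift c = trans (Prod-+ (α N) 1 t δ (suc c))
        (trans (Prod-L (λ i → α N (suc i)) t 0 δ (suc c)) (+-identityʳ _))

  -- Valuations of s(2ⁿ, i) for even and odd i

  module _ (a : ℕ) where

    open Expansion (2 ^ a)

    weight≡N² : weight a ≡ N ^ 2
    weight≡N² = trans (cong (2 ^_) (*-comm 2 (suc a))) (sym (^-*-assoc 2 (suc a) 2))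

    -- The choice h = 0 or 1 makes i the top exponent of `u c₀` or the one below it. Summands with
    -- smaller c vanish by degree; those with larger c gain powers of N from `u-∣`.
    stirling1-exact : ∀ c₀ h i → suc c₀ ≤ 2 ^ a → h ≤ 1 → i + h ≡ 2 * suc c₀ → Exact (h * a) (u c₀ i) →
      Exact (2 ^ suc a + χ (suc c₀) + lg (suc c₀) + h * a) (suc c₀ * weight a ^ suc c₀ * stirling1 N i)
    stirling1-exact c₀ h i e≤ h≤1 i+h≡ exact-u with 2^-suc-pred a
    ... | t , eq = subst (λ s → Exact T (e * weight a ^ e * s)) (sym (stirling1-expansion t eq i))
      (∑-exact (e * weight a ^ e) (2 ^ a) (λ c → P a (suc c) * u c i) c₀ e≤
        (subst (Exact T) (lem e (weight a ^ e) (P a e) (u c₀ i)) (exact-* (z-exact a e (s≤s z≤n) e≤) exact-u))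
        rest)
      where
      e T : ℕ
      e = suc c₀
      T = 2 ^ suc a + χ e + lg e + h * a
      lem : ∀ e w p u → e * (w * p) * u ≡ e * w * (p * u)
      lem = solve-∀

      below : ∀ c → c < c₀ → e * weight a ^ e * (P a (suc c) * u c i) ≡ 0
      below c c<c₀ = trans
        (cong (e * weight a ^ e *_) (trans (cong (P a (suc c) *_) (u-degree c i lt)) (*-zeroʳ (P a (suc c)))))
        (*-zeroʳ (e * weight a ^ e))
        where
        open ≤-Reasoning
        lem′ : ∀ c → 3 + 2 * c + 1 ≡ 2 * (2 + c)
        lem′ = solve-∀
        lt : 2 + 2 * c < i
        lt = +-cancelʳ-≤ 1 (3 + 2 * c) i (begin
          3 + 2 * c + 1    ≡⟨ lem′ c ⟩
          2 * (2 + c)      ≤⟨ *-monoʳ-≤ 2 (s≤s c<c₀) ⟩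
          2 * e            ≡⟨ i+h≡ ⟨
          i + h            ≤⟨ +-monoʳ-≤ i h≤1 ⟩
          i + 1            ∎)

      -- The exponent i lies 2g + h below the degree of `u c`, so twice the coefficient has the
      -- factor N^(2g + h). As the weight is N², N^(2g) lifts it from index e to d = e + g, where
      -- `z-∣` applies.
      above : ∀ g → 0 < g → 2 ^ suc T ∣ e * weight a ^ e * (P a (e + g) * u (c₀ + g) i)
      above g 0<g = *-cancelˡ-∣ 2 (∣-trans (2^-∣ bound)
        (subst (2 ^ (2 ^ suc a + χ d + suc a * h) ∣_) (sym rearranged)
          (∣n⇒∣m*n (e * v) (2^-∣-* {2 ^ suc a + χ d} (z-∣ a d) (∣-reflexive (sym (^-*-assoc 2 (suc a) h)))))))
        where
        c d : ℕ
        c = c₀ + g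
        d = e + g
        index : i + (2 * g + h) ≡ 2 + 2 * c
        index = trans (lem₁ i g h) (trans (cong (_+ 2 * g) i+h≡) (lem₂ c₀ g))
          where lem₁ : ∀ i g h → i + (2 * g + h) ≡ i + h + 2 * g
                lem₁ = solve-∀
                lem₂ : ∀ c g → 2 * suc c + 2 * g ≡ 2 + 2 * (c + g)
                lem₂ = solve-∀
        2u-∣ : N ^ (2 * g + h) ∣ 2 * u c i
        2u-∣ = u-∣ c i (2 * g + h) index
        v : ℕ
        v = quotient 2u-∣
        bound : suc (suc T) ≤ 2 ^ suc a + χ d + suc a * h
        bound = begin
          suc (suc T)                            ≡⟨ lem₁ (2 ^ suc a) (χ e) (lg e) (h * a) ⟩
          2 ^ suc a + (χ e + lg e + 2) + h * a
            ≤⟨ +-mono-≤ (+-monoʳ-≤ (2 ^ suc a) (χ-gap e d (s≤s z≤n) (m<m+n e 0<g))) (m≤n+m (h * a) h) ⟩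
          2 ^ suc a + χ d + (h + h * a)          ≡⟨ cong (2 ^ suc a + χ d +_) (lem₂ h a) ⟩
          2 ^ suc a + χ d + suc a * h            ∎
          where
          open ≤-Reasoning
          lem₁ : ∀ p x l y → suc (suc (p + x + l + y)) ≡ p + (x + l + 2) + y
          lem₁ = solve-∀
          lem₂ : ∀ h a → h + h * a ≡ suc a * h
          lem₂ = solve-∀
        power : N ^ (2 * g + h) ≡ weight a ^ g * N ^ h
        power = trans (^-distribˡ-+-* N (2 * g) h)
          (cong (_* N ^ h) (trans (sym (^-*-assoc N 2 g)) (cong (_^ g) (sym weight≡N²))))
        rearranged : 2 * (e * weight a ^ e * (P a d * u c i)) ≡ e * v * (z a d * N ^ h)
        rearranged = begin
          2 * (e * weight a ^ e * (P a d * u c i))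
            ≡⟨ lem₁ e (weight a ^ e) (P a d) (u c i) ⟩
          e * weight a ^ e * P a d * (2 * u c i)
            ≡⟨ cong (e * weight a ^ e * P a d *_) (trans (_∣_.equality 2u-∣) (cong (v *_) power)) ⟩
          e * weight a ^ e * P a d * (v * (weight a ^ g * N ^ h))
            ≡⟨ lem₂ e (weight a ^ e) (P a d) v (weight a ^ g) (N ^ h) ⟩
          e * v * (weight a ^ e * weight a ^ g * P a d * N ^ h)
            ≡⟨ cong (λ x → e * v * (x * P a d * N ^ h)) (sym (^-distribˡ-+-* (weight a) e g)) ⟩
          e * v * (weight a ^ d * P a d * N ^ h) ∎
          where
          open ≡-Reasoning
          lem₁ : ∀ e w p u → 2 * (e * w * (p * u)) ≡ e * w * p * (2 * u)
          lem₁ = solve-∀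
          lem₂ : ∀ e w p v x y → e * w * p * (v * (x * y)) ≡ e * v * (w * x * p * y)
          lem₂ = solve-∀

      rest : ∀ c → c < 2 ^ a → c ≢ c₀ → 2 ^ suc T ∣ e * weight a ^ e * (P a (suc c) * u c i)
      rest c c< c≢ with <-cmp c c₀
      ... | tri< c<c₀ _ _ = ∣-≡0 (below c c<c₀)
      ... | tri≈ _ c≡ _   = ⊥-elim (c≢ c≡)
      ... | tri> _ _ c₀<c with m≤n⇒∃[o]m+o≡n c₀<c
      ...   | g , refl = subst (λ c → 2 ^ suc T ∣ e * weight a ^ e * (P a (suc c) * u c i)) (+-suc c₀ g)
                (above (suc g) (s≤s z≤n))

    u-exact : ∀ c h i → h ≤ 1 → i + h ≡ 2 * suc c → Exact (h * a) (u c i)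
    u-exact c zero i _ eq = subst (Exact 0) (sym (trans (cong (u c) i≡) (u-leading c))) (exact-odd (0 , refl))
      where
      i≡ : i ≡ 2 + 2 * c
      i≡ = trans (sym (+-identityʳ i)) (trans eq (*-suc 2 c))
    u-exact c (suc zero) i _ eq = subst (Exact (a + 0)) (sym (trans (cong (u c) i≡) (u-subleading c)))
      (exact-* (exact-2^ a) (exact-odd (c , refl)))
      where
      i≡ : i ≡ 1 + 2 * c
      i≡ = suc-injective (trans (+-comm 1 i) (trans eq (*-suc 2 c)))
    u-exact c (suc (suc h)) i (s≤s ()) eq

    stirling1-valuation : ∀ e h i w → 0 < e → e ≤ 2 ^ a → h ≤ 1 → i + h ≡ 2 * e → Exact w e →
      ∃ λ v → Exact v (stirling1 (2 ^ suc a) i) × w + 2 * suc a * e + v ≡ 2 ^ suc a + χ e + lg e + h * a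
    stirling1-valuation (suc c) h i w _ e≤ h≤1 eq exact-e = exact-cancel
      (exact-* exact-e (subst (Exact (2 * suc a * suc c)) (sym (^-*-assoc 2 (2 * suc a) (suc c))) (exact-2^ _)))
      (stirling1-exact c h i e≤ h≤1 eq (u-exact c h i h≤1 eq))

  -- From the index 2e - h to the index 2ᵐ - k

  ε≡%2 : ∀ k → ε k ≡ k % 2
  ε≡%2 zero          = refl
  ε≡%2 (suc zero)    = refl
  ε≡%2 (suc (suc k)) = trans (ε≡%2 k) (sym (trans (cong (_% 2) (+-comm 2 k)) ([m+n]%n≡m%n k 2)))

  ε≤1 : ∀ k → ε k ≤ 1
  ε≤1 zero          = z≤n
  ε≤1 (suc zero)    = ≤-refl
  ε≤1 (suc (suc k)) = ε≤1 k

  k≡ε+2* : ∀ k → k ≡ ε k + 2 * (k / 2)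
  k≡ε+2* k = trans (m≡m%n+[m/n]*n k 2) (cong₂ _+_ (sym (ε≡%2 k)) (*-comm (k / 2) 2))

  -- Since w < b, 2ᵇ vanishes modulo 2^(w + 1), so e is congruent to -t there.
  exact-complement : ∀ {w t e b} → Exact w t → e + t ≡ 2 ^ b → w < b → Exact w e
  exact-complement {w} {t} {e} {b} exact-t e+t≡ w<b =
    ∣-¬∣⇒exact
      (∣m+n∣m⇒∣n {m = t} (subst (2 ^ w ∣_) (trans (sym e+t≡) (+-comm e t)) (2^-∣ (<⇒≤ w<b))) (exact-∣ exact-t))
      (λ h → exact-¬∣ exact-t (∣m+n∣m⇒∣n {m = e} (subst (2 ^ suc w ∣_) (sym e+t≡) (2^-∣ w<b)) h))

  -- The theorem with m = b + 2, n = b + 2 + d, t = ⌊k/2⌋, h = εₖ; the equation is free of subtraction.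
  stirling1-valuation-ℕ : ∀ b d t h w → 0 < t → t ≤ 2 ^ b → h ≤ 1 → Exact w t →
    ∃ λ v → Exact v (stirling1 (2 ^ (2 + b + d)) (2 ^ (2 + b) ∸ (h + 2 * t))) ×
      v + (2 ^ (2 + b) + d * 2 ^ (2 + b) + w) ≡ 2 ^ (2 + b + d) + 2 * d * t + b + (1 + b + d) * h
  stirling1-valuation-ℕ b d t h w 0<t t≤ h≤1 exact-t
    with m≤n⇒∃[o]m+o≡n (≤-trans t≤ (<⇒≤ (2^-suc-< b)))
  ... | e , t+e≡ = v , proj₁ (proj₂ result) , final
    where
    n a : ℕ
    a = 1 + b + d
    n = suc a
    -- Here e = 2ᵇ⁺¹ - t is half of 2ᵐ - k, rounded up. The bound t ≤ 2ᵇ places it in the interval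
    -- from 2ᵇ to 2ᵇ⁺¹, so that ⌊log₂ e⌋ is the constant b = m - 2.
    2^b≤e : 2 ^ b ≤ e
    2^b≤e = +-cancelˡ-≤ t _ _ (≤-trans (+-monoˡ-≤ (2 ^ b) t≤)
      (≤-reflexive (trans (cong (2 ^ b +_) (sym (+-identityʳ (2 ^ b)))) (sym t+e≡))))
    e< : e < 2 ^ suc b
    e< = subst (e <_) t+e≡ (+-monoˡ-≤ e 0<t)
    0<e : 0 < e
    0<e = ≤-trans (2^-pos b) 2^b≤e
    w<1+b : w < suc b
    w<1+b = 2^-cancel-< (≤-<-trans (∣⇒≤ {{>-nonZero 0<t}} (exact-∣ exact-t)) (≤-<-trans t≤ (2^-suc-< b)))
    lg≡b : lg e ≡ b
    lg≡b = lg-unique b e 2^b≤e e<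
    h≤2e : h ≤ 2 * e
    h≤2e = ≤-trans h≤1 (≤-trans 0<e (m≤m+n e _))
    2e∸h : 2 ^ (2 + b) ∸ (h + 2 * t) ≡ 2 * e ∸ h
    2e∸h = trans (cong₂ _∸_ (trans (cong (2 *_) (sym t+e≡)) (lem t e)) (+-comm h (2 * t)))
      (trans (sym (∸-+-assoc (2 * t + 2 * e) (2 * t) h)) (cong (_∸ h) (m+n∸m≡n (2 * t) (2 * e))))
      where lem : ∀ t e → 2 * (t + e) ≡ 2 * t + 2 * e
            lem = solve-∀
    index : 2 ^ (2 + b) ∸ (h + 2 * t) + h ≡ 2 * e
    index = trans (cong (_+ h) 2e∸h) (m∸n+n≡m h≤2e)
    result : ∃ λ v → Exact v (stirling1 (2 ^ n) (2 ^ (2 + b) ∸ (h + 2 * t))) ×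
      w + 2 * n * e + v ≡ 2 ^ n + χ e + lg e + h * a
    result = stirling1-valuation a e h _ w 0<e (≤-trans (<⇒≤ e<) (^-monoʳ-≤ 2 (m≤m+n (suc b) d)))
      h≤1 index (exact-complement exact-t (trans (+-comm e t) t+e≡) w<1+b)
    v : ℕ
    v = proj₁ result
    closed : χ e + 4 * 2 ^ b ≡ 2 * (b + 2) * e
    closed = trans (cong (λ l → χ e + 4 * 2 ^ l) (sym lg≡b))
      (trans (χ-closed e 0<e) (cong (λ l → 2 * (l + 2) * e) lg≡b))
    final : v + (2 ^ (2 + b) + d * 2 ^ (2 + b) + w) ≡ 2 ^ n + 2 * d * t + b + a * h
    -- Adding 2(b + 2)e to both sides lets the closed form of χ enter without subtraction.
    final = +-cancelˡ-≡ (2 * (b + 2) * e) _ _ (begin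
      2 * (b + 2) * e + (v + (2 * (2 * 2 ^ b) + d * (2 * 2 ^ suc b) + w))
        ≡⟨ cong (λ x → 2 * (b + 2) * e + (v + (2 * (2 * 2 ^ b) + d * (2 * x) + w))) (sym t+e≡) ⟩
      2 * (b + 2) * e + (v + (2 * (2 * 2 ^ b) + d * (2 * (t + e)) + w))
        ≡⟨ lem₁ b d e t w v (2 ^ b) ⟩
      w + 2 * (2 + b + d) * e + v + (4 * 2 ^ b + 2 * d * t)
        ≡⟨ cong (_+ (4 * 2 ^ b + 2 * d * t))
             (trans (proj₂ (proj₂ result)) (cong (λ l → 2 ^ n + χ e + l + h * a) lg≡b)) ⟩
      2 ^ n + χ e + b + h * a + (4 * 2 ^ b + 2 * d * t)
        ≡⟨ lem₂ (2 ^ n) (χ e) b (h * a) (2 ^ b) (2 * d * t) ⟩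
      χ e + 4 * 2 ^ b + (2 ^ n + 2 * d * t + b + h * a)
        ≡⟨ cong₂ (λ x y → x + (2 ^ n + 2 * d * t + b + y)) closed (*-comm h a) ⟩
      2 * (b + 2) * e + (2 ^ n + 2 * d * t + b + a * h) ∎)
      where
      open ≡-Reasoning
      lem₁ : ∀ b d e t w v p → 2 * (b + 2) * e + (v + (2 * (2 * p) + d * (2 * (t + e)) + w)) ≡
             w + 2 * (2 + b + d) * e + v + (4 * p + 2 * d * t)
      lem₁ = solve-∀
      lem₂ : ∀ p x b y q r → p + x + b + y + (4 * q + r) ≡ x + 4 * q + (p + r + b + y)
      lem₂ = solve-∀

open Naturals using (Exact; exact-∣; exact-¬∣; ∣-¬∣⇒exact; stirling1-valuation-ℕ; k≡ε+2*; ε≤1)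

open import Data.Nat using (ℕ; suc; zero; _≤_; _<_; z≤n; s≤s; s≤s⁻¹; _^_; _∸_; _/_)
open import Data.Integer using (+_; _-_; _+_; _*_)
open import Data.Product using (Σ; _×_; _,_; proj₁; proj₂)
open import Data.Empty using (⊥-elim)
open import Data.Integer.Properties using (pos-*)
open import Data.Integer.Tactic.RingSolver using (solve-∀)
open import Relation.Binary.PropositionalEquality using (_≡_; refl; sym; trans; cong; cong₂; subst)
import Data.Nat as ℕ
import Data.Nat.Properties as ℕ

-- Passage to integer arithmetic and to the variables n, m, k

half-positive : ∀ k → 2 ≤ k → 0 < k / 2
half-positive k 2≤k with k / 2 | k≡ε+2* k
... | suc _ | _  = s≤s z≤n
... | zero  | eq = ⊥-elim (ℕ.<⇒≱ 2≤k (subst (_≤ 1) (sym (trans eq (ℕ.+-identityʳ _))) (ε≤1 k)))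

half-bounded : ∀ b k → k ≤ 2 ^ suc b ℕ.+ 1 → k / 2 ≤ 2 ^ b
half-bounded b k k≤ = s≤s⁻¹ (ℕ.*-cancelˡ-< 2 (k / 2) (suc (2 ^ b)) (begin-strict
  2 ℕ.* (k / 2)             ≤⟨ ℕ.m≤n+m _ (ε k) ⟩
  ε k ℕ.+ 2 ℕ.* (k / 2)     ≡⟨ k≡ε+2* k ⟨
  k                         ≤⟨ k≤ ⟩
  2 ^ suc b ℕ.+ 1           <⟨ ℕ.+-monoʳ-< (2 ^ suc b) (s≤s (s≤s z≤n)) ⟩
  2 ^ suc b ℕ.+ 2           ≡⟨ trans (ℕ.+-comm (2 ^ suc b) 2) (sym (ℕ.*-suc 2 (2 ^ b))) ⟩
  2 ℕ.* suc (2 ^ b)         ∎))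
  where open ℕ.≤-Reasoning

valuation-in-ℤ : ∀ v M d w N t b a h →
  v ℕ.+ (M ℕ.+ d ℕ.* M ℕ.+ w) ≡ N ℕ.+ 2 ℕ.* d ℕ.* t ℕ.+ b ℕ.+ a ℕ.* h →
  + v ≡ (+ N - + M) - + d * (+ M - + 2 * + t) + (+ (2 ℕ.+ b) - + 2) - + w + + a * + h
valuation-in-ℤ v M d w N t b a h eq = trans (add-sub (+ v) (+ M + + d * + M + + w))
  (trans (cong (_- (+ M + + d * + M + + w)) eqℤ) (rearrange (+ M) (+ d) (+ w) (+ N) (+ t) (+ b) (+ a) (+ h)))
  where
  add-sub : ∀ x y → x ≡ x + y - y
  add-sub = solve-∀
  rearrange : ∀ M d w N t b a h → N + + 2 * d * t + b + a * h - (M + d * M + w) ≡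
    (N - M) - d * (M - + 2 * t) + ((+ 2 + b) - + 2) - w + a * h
  rearrange = solve-∀
  lhs : + (v ℕ.+ (M ℕ.+ d ℕ.* M ℕ.+ w)) ≡ + v + (+ M + + d * + M + + w)
  lhs = cong (λ x → + v + (+ M + x + + w)) (pos-* d M)
  rhs : + (N ℕ.+ 2 ℕ.* d ℕ.* t ℕ.+ b ℕ.+ a ℕ.* h) ≡ + N + + 2 * + d * + t + + b + + a * + h
  rhs = cong₂ (λ x y → + N + x + + b + y)
    (trans (pos-* (2 ℕ.* d) t) (cong (_* + t) (pos-* 2 d))) (pos-* a h)
  eqℤ : + v + (+ M + + d * + M + + w) ≡ + N + + 2 * + d * + t + + b + + a * + h
  eqℤ = trans (sym lhs) (trans (cong +_ eq) rhs)

-- The difference n − m is a separate argument because the statement computes it with ∸.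
Conclusion : (n m k w n-m : ℕ) → Set
Conclusion n m k w n-m = Σ ℕ (λ v → HasValuation 2 (stirling1 (2 ^ n) (2 ^ m ∸ k)) v
  × (+ v ≡ (+ (2 ^ n) - + (2 ^ m)) - (+ n-m) * (+ (2 ^ m) - + 2 * + (k / 2))
           + (+ m - + 2) - + w + (+ (n ∸ 1)) * (+ ε k)))

conclusion : ∀ b d k w → 2 ≤ k → k ≤ 2 ^ suc b ℕ.+ 1 → HasValuation 2 (k / 2) w →
  Conclusion (2 ℕ.+ b ℕ.+ d) (2 ℕ.+ b) k w d
conclusion b d k w 2≤k k≤ (2^w∣ , 2^1+w∤) =
  v , (exact-∣ {v} exact-s , exact-¬∣ {v} exact-s) ,
  valuation-in-ℤ v (2 ^ (2 ℕ.+ b)) d w (2 ^ (2 ℕ.+ b ℕ.+ d)) (k / 2) b (1 ℕ.+ b ℕ.+ d) (ε k)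
    (proj₂ (proj₂ result))
  where
  S : ℕ → ℕ
  S j = stirling1 (2 ^ (2 ℕ.+ b ℕ.+ d)) (2 ^ (2 ℕ.+ b) ∸ j)
  result : Σ ℕ λ v → Exact v (S (ε k ℕ.+ 2 ℕ.* (k / 2))) ×
    v ℕ.+ (2 ^ (2 ℕ.+ b) ℕ.+ d ℕ.* 2 ^ (2 ℕ.+ b) ℕ.+ w) ≡
    2 ^ (2 ℕ.+ b ℕ.+ d) ℕ.+ 2 ℕ.* d ℕ.* (k / 2) ℕ.+ b ℕ.+ (1 ℕ.+ b ℕ.+ d) ℕ.* ε k
  result = stirling1-valuation-ℕ b d (k / 2) (ε k) w (half-positive k 2≤k) (half-bounded b k k≤) (ε≤1 k)
    (∣-¬∣⇒exact {w} 2^w∣ 2^1+w∤)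
  v : ℕ
  v = proj₁ result
  exact-s : Exact v (S k)
  exact-s = subst (λ j → Exact v (S j)) (sym (k≡ε+2* k)) (proj₁ (proj₂ result))

theorem1p1 : (n m k : ℕ) → 2 ≤ m → m ≤ n → 2 ≤ k → k ≤ 2 ^ (m ∸ 1) Data.Nat.+ 1 →
    (w : ℕ) → HasValuation 2 (k / 2) w →
    Σ ℕ (λ v → HasValuation 2 (stirling1 (2 ^ n) (2 ^ m ∸ k)) v
    × (+ v ≡ (+ (2 ^ n) - + (2 ^ m)) - (+ (n ∸ m)) * (+ (2 ^ m) - + 2 * + (k / 2))
    + (+ m - + 2) - + w + (+ (n ∸ 1)) * (+ ε k)))
theorem1p1 n m k 2≤m m≤n 2≤k k≤ w val = shifted (ℕ.m≤n⇒∃[o]m+o≡n 2≤m) (ℕ.m≤n⇒∃[o]m+o≡n m≤n) k≤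
  where
  shifted : Σ ℕ (λ b → 2 ℕ.+ b ≡ m) → Σ ℕ (λ d → m ℕ.+ d ≡ n) → k ≤ 2 ^ (m ∸ 1) ℕ.+ 1 →
    Conclusion n m k w (n ∸ m)
  shifted (b , refl) (d , refl) k≤ =
    subst (Conclusion (2 ℕ.+ b ℕ.+ d) (2 ℕ.+ b) k w) (sym (ℕ.m+n∸m≡n b d)) (conclusion b d k w 2≤k k≤ val)
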